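{- Let $T$ be a rooted tree on vertex set $\{1,\dots,n\}$ with root $1$. Then the space $\mathcal{P}_n(GX_n)$ of homogeneous polynomials of degree $n$ in the central $\mathcal{P}$-space $\mathcal{P}(GX_n)$ is spanned by monomials, and the reference monomials $\{\mathrm{Ref}_{T_k}: k\in\{\pm1\}^n,\ k(1)=1\}$ form a basis of $\mathcal{P}_n(GX_n)$.
   Context: For $k\in\{\pm1\}^n$ with $k(1)=1$, let $T_k$ be the directed tree obtained from $T$ by orienting, for each non-root vertex $i$ with parent $p$, the edge $\{p,i\}$ towards $i$ if $k(i)=1$ and towards $p$ if $k(i)=-1$. The generalized broken wheel graph $GBW_n(T_k)$ is obtained from $T_k$ by adding a vertex $0$, two parallel edges directed from $0$ to $1$, and one edge directed from $0$ to $i$ for each $2\le i\le n$. The weight of a vertex $v\in\{1,\dots,n\}$ is $w_{T_k}(v)=\mathrm{indeg}(v)-1$ (indegree in $GBW_n(T_k)$), and the reference monomial is $\mathrm{Ref}_{T_k}(t)=\prod_{i=1}^n t_i^{w_{T_k}(i)}$. Let $GX_n$ be the $n\times 2n$ matrix whose columns are the vectors $e_j-e_i$ (with $e_0:=0$, $(e_i)$ the standard basis of $\mathbb{R}^n$), one for each edge of the underlying undirected multigraph of $GBW_n(T_k)$ joining $i$ and $j$, with any fixed choice of sign (this does not depend on $k$ up to signs). For $x=\sum\lambda_ie_i$ let $p_x=\sum\lambda_it_i$ and for a sub-multiset $R$ of columns $p_R=\prod_{x\in R}p_x$. The central $\mathcal{P}$-space is $\mathcal{P}(GX_n)=\operatorname{span}\{p_R: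 R\subseteq GX_n,\ GX_n\setminus R \text{ has rank } n\}$.
   Formalization: The polynomials, the span defining the central P-space, the rank condition and the linear combinations are taken over the rational numbers instead of the real numbers. -}

module Defs where

open import Data.Nat as ℕ using (ℕ; zero; suc)
open import Data.Fin as Fin using (Fin; zero; suc)
open import Data.Fin.Properties using () renaming (_≟_ to _≟ᶠ_)
open import Data.Rational as ℚ using (ℚ; 0ℚ; 1ℚ)
open import Data.Bool using (Bool; true; false; if_then_else_; not)
open import Data.Sign using (Sign)
open import Data.List as List using (List; []; _∷_; _++_; length; allFin; concatMap; filter; foldr)
open import Data.Vec as Vec using (Vec; []; _∷_; tabulate; lookup)
import Data.Vec.Properties as VecP
open import Data.Product using (Σ; ∃; _×_; _,_; proj₁; proj₂)
open import Function.Base using (_∘_)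
open import Relation.Nullary using (¬_)
open import Relation.Nullary.Decidable using (⌊_⌋; does)
open import Relation.Binary.PropositionalEquality using (_≡_)
open import Data.List.Relation.Unary.All using (All)

-- Rooted trees on {1,…,n}, n = suc m.  Vertex i of the paper is the
-- element (i-1) of Fin (suc m); the root 1 is `zero`.  A rooted tree is
-- given by its parent map; `parent zero` is an unused junk value.  The
-- tree condition: iterating the parent map from any vertex reaches the root.

iter : ∀ {A : Set} → (A → A) → ℕ → A → A
iter f zero    a = a
iter f (suc k) a = f (iter f k a)

record RootedTree (m : ℕ) : Set where
  field
    parent  : Fin (suc m) → Fin (suc m)
    reaches : ∀ v → ∃ λ k → iter parent k v ≡ zero
open RootedTree public

-- The directed multigraph GBW_n(T_k).  Its vertices are Fin (suc n):
-- `zero` is the extra vertex 0 and `suc v` is tree vertex v.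
-- Directed edges are pairs (tail , head).

Edge : ℕ → Set
Edge n = Fin (suc n) × Fin (suc n)

SignVec : ℕ → Set
SignVec m = Σ (Vec Sign (suc m)) (λ k → lookup k zero ≡ Sign.+)

treeEdge : ∀ {m} → RootedTree m → Vec Sign (suc m) → Fin (suc m) → Edge (suc m)
treeEdge T k i with lookup k i
... | Sign.+ = (suc (parent T i) , suc i)
... | Sign.- = (suc i , suc (parent T i))

GBW : ∀ {m} → RootedTree m → Vec Sign (suc m) → List (Edge (suc m))
GBW {m} T k =
  (zero , suc zero) ∷ (zero , suc zero) ∷
  (List.map (λ i → (zero , suc (suc i))) (allFin m) ++
   List.map (λ i → treeEdge T k (suc i)) (allFin m))

indeg : ∀ {n} → List (Edge n) → Fin (suc n) → ℕ
indeg es v = length (filter (λ e → proj₂ e ≟ᶠ v) es)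

weight : ∀ {m} → RootedTree m → Vec Sign (suc m) → Fin (suc m) → ℕ
weight T k v = indeg (GBW T k) (suc v) ℕ.∸ 1

-- Polynomials in t_1,…,t_n over ℚ, as finite lists of terms
-- (coefficient , exponent vector); two polynomials are equal when all
-- their coefficients agree.

Monomial : ℕ → Set
Monomial n = Vec ℕ n

Poly : ℕ → Set
Poly n = List (ℚ × Monomial n)

coeff : ∀ {n} → Poly n → Monomial n → ℚ
coeff []            α = 0ℚ
coeff ((c , β) ∷ p) α =
  if does (VecP.≡-dec ℕ._≟_ β α) then c ℚ.+ coeff p α else coeff p α

infix 4 _≈ₚ_
_≈ₚ_ : ∀ {n} → Poly n → Poly n → Set
p ≈ₚ q = ∀ α → coeff p α ≡ coeff q α

zeroP : ∀ {n} → Poly n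
zeroP = []

oneP : ∀ {n} → Poly n
oneP {n} = (1ℚ , Vec.replicate n 0) ∷ []

_+ₚ_ : ∀ {n} → Poly n → Poly n → Poly n
p +ₚ q = p ++ q

scaleP : ∀ {n} → ℚ → Poly n → Poly n
scaleP a = List.map (λ t → (a ℚ.* proj₁ t , proj₂ t))

_*ₚ_ : ∀ {n} → Poly n → Poly n → Poly n
p *ₚ q = concatMap (λ s → List.map (λ t → (proj₁ s ℚ.* proj₁ t , Vec.zipWith ℕ._+_ (proj₂ s) (proj₂ t))) q) p

sumP : ∀ {n} → List (Poly n) → Poly n
sumP = foldr _+ₚ_ zeroP

prodP : ∀ {n} → List (Poly n) → Poly n
prodP = foldr _*ₚ_ oneP

mono : ∀ {n} → Monomial n → Poly n
mono α = (1ℚ , α) ∷ []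

Ref : ∀ {m} → RootedTree m → Vec Sign (suc m) → Monomial (suc m)
Ref T k = tabulate (weight T k)

Homogeneous : ∀ {n} → ℕ → Poly n → Set
Homogeneous d f = ∀ α → ¬ (Vec.sum α ≡ d) → coeff f α ≡ 0ℚ

Vector : ℕ → Set
Vector n = Fin n → ℚ

evec : ∀ {n} → Fin (suc n) → Vector n
evec zero    i = 0ℚ
evec (suc j) i = if ⌊ j ≟ᶠ i ⌋ then 1ℚ else 0ℚ

column : ∀ {n} → Edge n → Vector n
column (a , b) i = evec b i ℚ.- evec a i

-- all-(+1) sign vector: orientation used to fix the signs of GX_n
allPlus : ∀ m → Vec Sign (suc m)
allPlus m = Vec.replicate (suc m) Sign.+

GX : ∀ {m} → RootedTree m → List (Vector (suc m))
GX {m} T = List.map column (GBW T (allPlus m))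

sumℚ : List ℚ → ℚ
sumℚ = foldr ℚ._+_ 0ℚ

FullRank : ∀ {n} → List (Vector n) → Set
FullRank {n} S = ∀ (v : Vector n) → ∃ λ (cs : List ℚ) →
  ∀ i → v i ≡ sumℚ (List.zipWith (λ c s → c ℚ.* s i) cs S)

-- sub-multisets of the columns, as selections
select : ∀ {A : Set} (xs : List A) → Vec Bool (length xs) → List A
select []       []          = []
select (x ∷ xs) (true ∷ b)  = x ∷ select xs b
select (x ∷ xs) (false ∷ b) = select xs b

linP : ∀ {n} → Vector n → Poly n
linP {n} x = List.map (λ i → (x i , tabulate (λ j → if ⌊ i ≟ᶠ j ⌋ then 1 else 0))) (allFin n)

pR : ∀ {n} → List (Vector n) → Poly n
pR R = prodP (List.map linP R)

InP : ∀ {m} → RootedTree m → Poly (suc m) → Set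
InP T f = ∃ λ (L : List (ℚ × Vec Bool (length (GX T)))) →
  All (λ t → FullRank (select (GX T) (Vec.map not (proj₂ t)))) L ×
  f ≈ₚ sumP (List.map (λ t → scaleP (proj₁ t) (pR (select (GX T) (proj₂ t)))) L)

InPn : ∀ {m} → RootedTree m → Poly (suc m) → Set
InPn {m} T f = InP T f × Homogeneous (suc m) f

{-# OPTIONS --safe #-}

-- Ref_{T_k} = t_1 ∏_{i≥2} z_i with z_i = t_i if k(i) = 1 and z_i = t_{p(i)} otherwise.
--
-- Membership: expand every factor t_p as t_i − (t_i − t_p).  Each resulting product is a p_R whose
-- complement has one of e_i, e_i − e_p for every i ≥ 2, besides e_1, and hence is a basis.
--
-- Spanning: let R have n elements and a complement B of rank n.  Each element of B can be assigned
-- a coordinate at which it is nonzero, every coordinate being used once.  A monomial t^α of p_R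
-- assigns such a coordinate to each element of R.  Altogether every edge of the wheel is oriented
-- towards a vertex ≠ 0 and vertex i has indegree α_i + 1, that is t^α = Ref_{T_k} for some k.
--
-- Independence: if Ref_{T_k} = Ref_{T_k′} and k(i) = 1, k′(i) = −1, comparing the exponents of t_i
-- gives a child of i with the same property; iterating contradicts finiteness of the tree.
module Submission where

open import Defs
open import Algebra.Properties.CommutativeSemigroup using (interchange; x∙yz≈y∙xz)
open import Data.Bool using (Bool; true; false; if_then_else_; not)
open import Data.Fin using (Fin; zero; suc)
open import Data.Fin.Properties using (any?; suc-injective) renaming (_≟_ to _≟ᶠ_)
open import Data.List using (List; []; _∷_; _++_; map; length; allFin; tabulate; zipWith)
import Data.List.Membership.DecPropositional as DecMembership
open import Data.List.Membership.Propositional using (_∈_; _∉_)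
open import Data.List.Membership.Propositional.Properties using (∈-allFin; ∈-++⁺ˡ; ∈-++⁺ʳ)
import Data.List.Properties as ListP
open import Data.List.Relation.Binary.Pointwise as PW using (Pointwise; []; _∷_)
open import Data.List.Relation.Binary.Sublist.Heterogeneous.Properties using (length-mono-≤; toPointwise)
open import Data.List.Relation.Binary.Sublist.Propositional using (_⊆_; []; _∷_; _∷ʳ_)
open import Data.List.Relation.Ternary.Interleaving.Properties using (interleave-length) renaming (++⁺ to interleaving-++⁺)
open import Data.List.Relation.Ternary.Interleaving.Propositional using (Interleaving; []; consˡ; consʳ; swap)
open import Data.List.Relation.Unary.All as All using (All; []; _∷_)
import Data.List.Relation.Unary.All.Properties as AllP
open import Data.List.Relation.Unary.AllPairs using (_∷_)
open import Data.List.Relation.Unary.Any using (here; there)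
open import Data.List.Relation.Unary.Unique.Propositional using (Unique)
open import Data.Nat as ℕ using (ℕ; zero; suc; _≤_; _<_; z≤n; s≤s)
import Data.Nat.Properties as ℕP
open import Data.Product using (∃; _×_; _,_; proj₁; proj₂)
open import Data.Rational as ℚ using (ℚ; 0ℚ; 1ℚ)
import Data.Rational.Properties as ℚP
open import Data.Rational.Solver using (module +-*-Solver)
open import Data.Sign using (Sign)
open import Data.Sum using (_⊎_; inj₁; inj₂)
open import Data.Vec as Vec using (Vec; []; _∷_; lookup)
import Data.Vec.Properties as VecP
open import Function using (_∘_; id)
open import Relation.Binary.PropositionalEquality
open import Relation.Nullary using (¬_; Dec; yes; no; contradiction; does; ¬?; _×-dec_)
open import Relation.Nullary.Decidable using (decidable-stable; ⌊_⌋)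
open +-*-Solver using (solve; _:=_; _:+_; _:*_; _:-_; :-_; con)
open ≡-Reasoning

module _ {n : ℕ} where
  open DecMembership (_≟ᶠ_ {n}) public using (_∈?_)

-- Polynomials as functionals on monomials

eval : ∀ {n} → Poly n → (Monomial n → ℚ) → ℚ
eval []            φ = 0ℚ
eval ((c , α) ∷ p) φ = c ℚ.* φ α ℚ.+ eval p φ

-- Equality under every functional on monomials; it makes the semiring laws Fubini-type identities.
infix 4 _≋_
record _≋_ {n} (p q : Poly n) : Set where
  constructor pointwise
  field
    at : ∀ φ → eval p φ ≡ eval q φ
open _≋_

≋-refl : ∀ {n} {p : Poly n} → p ≋ p
≋-refl .at φ = refl

≋-sym : ∀ {n} {p q : Poly n} → p ≋ q → q ≋ p
≋-sym e .at φ = sym (e .at φ)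

≋-trans : ∀ {n} {p q r : Poly n} → p ≋ q → q ≋ r → p ≋ r
≋-trans e f .at φ = trans (e .at φ) (f .at φ)

indicator : ∀ {n} → Monomial n → Monomial n → ℚ
indicator α β = if does (VecP.≡-dec ℕ._≟_ β α) then 1ℚ else 0ℚ

-- Taking a coefficient is one particular functional, so identities proved for all functionals
-- transfer to `_≈ₚ_`.
coeff-eval : ∀ {n} (p : Poly n) α → coeff p α ≡ eval p (indicator α)
coeff-eval []            α = refl
coeff-eval ((c , β) ∷ p) α with does (VecP.≡-dec ℕ._≟_ β α)
... | true  = cong₂ ℚ._+_ (sym (ℚP.*-identityʳ c)) (coeff-eval p α)
... | false = trans (coeff-eval p α)
  (solve 2 (λ c e → e := c :* con 0ℚ :+ e) refl c (eval p (indicator α)))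

≋⇒≈ₚ : ∀ {n} {p q : Poly n} → p ≋ q → p ≈ₚ q
≋⇒≈ₚ {p = p} {q} e α = trans (coeff-eval p α) (trans (e .at (indicator α)) (sym (coeff-eval q α)))

eval-++ : ∀ {n} (p q : Poly n) φ → eval (p ++ q) φ ≡ eval p φ ℚ.+ eval q φ
eval-++ []            q φ = sym (ℚP.+-identityˡ _)
eval-++ ((c , α) ∷ p) q φ =
  trans (cong (c ℚ.* φ α ℚ.+_) (eval-++ p q φ)) (sym (ℚP.+-assoc (c ℚ.* φ α) _ _))

eval-scale : ∀ {n} a (p : Poly n) φ → eval (scaleP a p) φ ≡ a ℚ.* eval p φ
eval-scale a []            φ = sym (ℚP.*-zeroʳ a)
eval-scale a ((c , α) ∷ p) φ = trans (cong (a ℚ.* c ℚ.* φ α ℚ.+_) (eval-scale a p φ))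
  (solve 4 (λ a c x e → a :* c :* x :+ a :* e := a :* (c :* x :+ e)) refl a c (φ α) (eval p φ))

eval-cong : ∀ {n} (p : Poly n) {φ ψ} → (∀ α → φ α ≡ ψ α) → eval p φ ≡ eval p ψ
eval-cong []            e = refl
eval-cong ((c , α) ∷ p) e = cong₂ ℚ._+_ (cong (c ℚ.*_) (e α)) (eval-cong p e)

eval-linear : ∀ {n} (p : Poly n) a φ ψ →
  eval p (λ α → a ℚ.* φ α ℚ.+ ψ α) ≡ a ℚ.* eval p φ ℚ.+ eval p ψ
eval-linear []            a φ ψ = solve 1 (λ a → con 0ℚ := a :* con 0ℚ :+ con 0ℚ) refl a
eval-linear ((c , α) ∷ p) a φ ψ = trans (cong (c ℚ.* (a ℚ.* φ α ℚ.+ ψ α) ℚ.+_) (eval-linear p a φ ψ))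
  (solve 6 (λ a c x y e f → c :* (a :* x :+ y) :+ (a :* e :+ f) := a :* (c :* x :+ e) :+ (c :* y :+ f))
    refl a c (φ α) (ψ α) (eval p φ) (eval p ψ))

eval-zero : ∀ {n} (p : Poly n) → eval p (λ _ → 0ℚ) ≡ 0ℚ
eval-zero []            = refl
eval-zero ((c , α) ∷ p) =
  trans (cong (c ℚ.* 0ℚ ℚ.+_) (eval-zero p)) (solve 1 (λ c → c :* con 0ℚ :+ con 0ℚ := con 0ℚ) refl c)

-- Interchange of two finite sums, by linearity of `eval q` in its functional. Commutativity of
-- multiplication comes from here.
eval-swap : ∀ {n} (p q : Poly n) (F : Monomial n → Monomial n → ℚ) →
  eval p (λ α → eval q (F α)) ≡ eval q (λ β → eval p (λ α → F α β))
eval-swap []            q F = sym (eval-zero q)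
eval-swap ((c , α) ∷ p) q F =
  trans (cong (c ℚ.* eval q (F α) ℚ.+_) (eval-swap p q F)) (sym (eval-linear q c (F α) (λ β → eval p (λ α → F α β))))

infixl 7 _∙_
_∙_ : ∀ {n} → Monomial n → Monomial n → Monomial n
_∙_ = Vec.zipWith ℕ._+_

∙-leftComm : ∀ {n} (α β γ : Monomial n) → α ∙ (β ∙ γ) ≡ β ∙ (α ∙ γ)
∙-leftComm []      []      []      = refl
∙-leftComm (a ∷ α) (b ∷ β) (c ∷ γ) = cong₂ _∷_ eq (∙-leftComm α β γ)
  where
  eq : a ℕ.+ (b ℕ.+ c) ≡ b ℕ.+ (a ℕ.+ c)
  eq = trans (sym (ℕP.+-assoc a b c)) (trans (cong (ℕ._+ c) (ℕP.+-comm a b)) (ℕP.+-assoc b a c))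

eval-shift : ∀ {n} c (α : Monomial n) q φ →
  eval (map (λ t → (c ℚ.* proj₁ t , α ∙ proj₂ t)) q) φ ≡ c ℚ.* eval q (λ β → φ (α ∙ β))
eval-shift c α []            φ = sym (ℚP.*-zeroʳ c)
eval-shift c α ((d , β) ∷ q) φ = trans (cong (c ℚ.* d ℚ.* φ (α ∙ β) ℚ.+_) (eval-shift c α q φ))
  (solve 4 (λ c d x e → c :* d :* x :+ c :* e := c :* (d :* x :+ e)) refl c d (φ (α ∙ β))
    (eval q (λ β → φ (α ∙ β))))

-- A product becomes an iterated sum: each term of `p` translates the functional that is applied to
-- `q`.
eval-* : ∀ {n} (p q : Poly n) φ → eval (p *ₚ q) φ ≡ eval p (λ α → eval q (λ β → φ (α ∙ β)))
eval-* []            q φ = refl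
eval-* ((c , α) ∷ p) q φ =
  trans (eval-++ (map _ q) (p *ₚ q) φ) (cong₂ ℚ._+_ (eval-shift c α q φ) (eval-* p q φ))

*ₚ-cong : ∀ {n} {p p′ q q′ : Poly n} → p ≋ p′ → q ≋ q′ → p *ₚ q ≋ p′ *ₚ q′
*ₚ-cong {p = p} {p′} {q} {q′} e f .at φ = begin
  eval (p *ₚ q) φ                               ≡⟨ eval-* p q φ ⟩
  eval p (λ α → eval q (λ β → φ (α ∙ β)))       ≡⟨ eval-cong p (λ α → f .at (λ β → φ (α ∙ β))) ⟩
  eval p (λ α → eval q′ (λ β → φ (α ∙ β)))      ≡⟨ e .at _ ⟩
  eval p′ (λ α → eval q′ (λ β → φ (α ∙ β)))     ≡⟨ eval-* p′ q′ φ ⟨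
  eval (p′ *ₚ q′) φ                             ∎

*ₚ-congˡ : ∀ {n} (p : Poly n) {q q′} → q ≋ q′ → p *ₚ q ≋ p *ₚ q′
*ₚ-congˡ p = *ₚ-cong (≋-refl {p = p})

-- Both sides are the same triple sum after an interchange. Since `prodP` nests to the right, this
-- combination of associativity and commutativity is what moves a factor to the front.
*ₚ-leftComm : ∀ {n} (p q r : Poly n) → p *ₚ (q *ₚ r) ≋ q *ₚ (p *ₚ r)
*ₚ-leftComm p q r .at φ = begin
  eval (p *ₚ (q *ₚ r)) φ                                               ≡⟨ expand p q ⟩
  eval p (λ α → eval q (λ β → eval r (λ γ → φ (α ∙ (β ∙ γ)))))         ≡⟨ eval-swap p q _ ⟩
  eval q (λ β → eval p (λ α → eval r (λ γ → φ (α ∙ (β ∙ γ)))))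
    ≡⟨ eval-cong q (λ β → eval-cong p λ α → eval-cong r λ γ → cong φ (∙-leftComm α β γ)) ⟩
  eval q (λ β → eval p (λ α → eval r (λ γ → φ (β ∙ (α ∙ γ)))))         ≡⟨ expand q p ⟨
  eval (q *ₚ (p *ₚ r)) φ                                               ∎
  where
  expand : ∀ s t → eval (s *ₚ (t *ₚ r)) φ ≡ eval s (λ α → eval t (λ β → eval r (λ γ → φ (α ∙ (β ∙ γ)))))
  expand s t = trans (eval-* s (t *ₚ r) φ) (eval-cong s (λ α → eval-* t r _))

prodP-shift : ∀ {n} (ps : List (Poly n)) q qs → prodP (ps ++ q ∷ qs) ≋ q *ₚ prodP (ps ++ qs)
prodP-shift []       q qs = ≋-refl
prodP-shift (p ∷ ps) q qs = ≋-trans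
  (*ₚ-congˡ p (prodP-shift ps q qs)) (*ₚ-leftComm p q (prodP (ps ++ qs)))

-- Formal linear combinations of an indexed family

lincomb : ∀ {n} {H : Set} → (H → Poly n) → List (ℚ × H) → Poly n
lincomb P L = sumP (map (λ t → scaleP (proj₁ t) (P (proj₂ t))) L)

eval-lincomb-∷ : ∀ {n} {H : Set} (P : H → Poly n) c h L φ →
  eval (lincomb P ((c , h) ∷ L)) φ ≡ c ℚ.* eval (P h) φ ℚ.+ eval (lincomb P L) φ
eval-lincomb-∷ P c h L φ =
  trans (eval-++ (scaleP c (P h)) (lincomb P L) φ) (cong (ℚ._+ _) (eval-scale c (P h) φ))

lincomb-cong : ∀ {n} {H K : Set} {P : H → Poly n} {Q : K → Poly n} (g : H → K) →
  (∀ h → P h ≋ Q (g h)) → ∀ L → lincomb P L ≋ lincomb Q (map (λ t → proj₁ t , g (proj₂ t)) L)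
lincomb-cong g e [] .at φ = refl
lincomb-cong {P = P} {Q} g e ((c , h) ∷ L) .at φ = begin
  eval (lincomb P ((c , h) ∷ L)) φ                    ≡⟨ eval-lincomb-∷ P c h L φ ⟩
  c ℚ.* eval (P h) φ ℚ.+ eval (lincomb P L) φ
    ≡⟨ cong₂ (λ x y → c ℚ.* x ℚ.+ y) (e h .at φ) (lincomb-cong {P = P} {Q} g e L .at φ) ⟩
  c ℚ.* eval (Q (g h)) φ ℚ.+ eval (lincomb Q gL) φ    ≡⟨ eval-lincomb-∷ Q c (g h) gL φ ⟨
  eval (lincomb Q ((c , g h) ∷ gL)) φ                 ∎
  where gL = map (λ t → proj₁ t , g (proj₂ t)) L

*ₚ-lincomb : ∀ {n} {H : Set} (q : Poly n) (P : H → Poly n) L →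
  q *ₚ lincomb P L ≋ lincomb (λ h → q *ₚ P h) L
*ₚ-lincomb q P []            .at φ = trans (eval-* q [] φ) (eval-zero q)
*ₚ-lincomb q P ((c , h) ∷ L) .at φ = begin
  eval (q *ₚ lincomb P ((c , h) ∷ L)) φ
    ≡⟨ eval-* q _ φ ⟩
  eval q (λ α → eval (lincomb P ((c , h) ∷ L)) (λ β → φ (α ∙ β)))
    ≡⟨ eval-cong q (λ α → eval-lincomb-∷ P c h L _) ⟩
  eval q (λ α → c ℚ.* eval (P h) (λ β → φ (α ∙ β)) ℚ.+ eval (lincomb P L) (λ β → φ (α ∙ β)))
    ≡⟨ eval-linear q c _ _ ⟩
  c ℚ.* eval q (λ α → eval (P h) (λ β → φ (α ∙ β))) ℚ.+ eval q (λ α → eval (lincomb P L) (λ β → φ (α ∙ β)))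
    ≡⟨ cong₂ (λ x y → c ℚ.* x ℚ.+ y) (eval-* q (P h) φ) (eval-* q (lincomb P L) φ) ⟨
  c ℚ.* eval (q *ₚ P h) φ ℚ.+ eval (q *ₚ lincomb P L) φ
    ≡⟨ cong (c ℚ.* eval (q *ₚ P h) φ ℚ.+_) (*ₚ-lincomb q P L .at φ) ⟩
  c ℚ.* eval (q *ₚ P h) φ ℚ.+ eval (lincomb (λ h → q *ₚ P h) L) φ
    ≡⟨ eval-lincomb-∷ (λ h → q *ₚ P h) c h L φ ⟨
  eval (lincomb (λ h → q *ₚ P h) ((c , h) ∷ L)) φ ∎

lincomb-++ : ∀ {n} {H : Set} (P : H → Poly n) L M φ →
  eval (lincomb P (L ++ M)) φ ≡ eval (lincomb P L) φ ℚ.+ eval (lincomb P M) φ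
lincomb-++ P []            M φ = sym (ℚP.+-identityˡ _)
lincomb-++ P ((c , h) ∷ L) M φ = begin
  eval (lincomb P ((c , h) ∷ L ++ M)) φ                       ≡⟨ eval-lincomb-∷ P c h (L ++ M) φ ⟩
  c ℚ.* eval (P h) φ ℚ.+ eval (lincomb P (L ++ M)) φ          ≡⟨ cong (c ℚ.* eval (P h) φ ℚ.+_) (lincomb-++ P L M φ) ⟩
  c ℚ.* eval (P h) φ ℚ.+ (eval (lincomb P L) φ ℚ.+ eval (lincomb P M) φ)
    ≡⟨ ℚP.+-assoc (c ℚ.* eval (P h) φ) _ _ ⟨
  c ℚ.* eval (P h) φ ℚ.+ eval (lincomb P L) φ ℚ.+ eval (lincomb P M) φ
    ≡⟨ cong (ℚ._+ _) (eval-lincomb-∷ P c h L φ) ⟨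
  eval (lincomb P ((c , h) ∷ L)) φ ℚ.+ eval (lincomb P M) φ   ∎

lincomb-scale : ∀ {n} {H : Set} (P : H → Poly n) a L φ →
  eval (lincomb P (map (λ t → a ℚ.* proj₁ t , proj₂ t) L)) φ ≡ a ℚ.* eval (lincomb P L) φ
lincomb-scale P a []            φ = sym (ℚP.*-zeroʳ a)
lincomb-scale P a ((c , h) ∷ L) φ = begin
  eval (lincomb P ((a ℚ.* c , h) ∷ aL)) φ                          ≡⟨ eval-lincomb-∷ P (a ℚ.* c) h aL φ ⟩
  a ℚ.* c ℚ.* eval (P h) φ ℚ.+ eval (lincomb P aL) φ               ≡⟨ cong (a ℚ.* c ℚ.* eval (P h) φ ℚ.+_) (lincomb-scale P a L φ) ⟩
  a ℚ.* c ℚ.* eval (P h) φ ℚ.+ a ℚ.* eval (lincomb P L) φ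
    ≡⟨ solve 4 (λ a c x y → a :* c :* x :+ a :* y := a :* (c :* x :+ y)) refl a c (eval (P h) φ) (eval (lincomb P L) φ) ⟩
  a ℚ.* (c ℚ.* eval (P h) φ ℚ.+ eval (lincomb P L) φ)              ≡⟨ cong (a ℚ.*_) (eval-lincomb-∷ P c h L φ) ⟨
  a ℚ.* eval (lincomb P ((c , h) ∷ L)) φ                           ∎
  where aL = map (λ t → a ℚ.* proj₁ t , proj₂ t) L

-- Expanding a product of two-term factors

branch : ∀ {A : Set} {m} → (Fin m → A) → (Fin m → A) → Vec Bool m → Fin m → A
branch e w h i = if lookup h i then e i else w i

-- Distributivity, one factor at a time: a Boolean vector records which summand each factor
-- contributes, and the scalars `a i` collect in the coefficients of `L`.
prodP-expand : ∀ {n m} (u e w : Fin m → Poly n) (a : Fin m → ℚ) →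
  (∀ i → u i ≋ e i +ₚ scaleP (a i) (w i)) →
  ∃ λ (L : List (ℚ × Vec Bool m)) →
    prodP (tabulate u) ≋ lincomb (λ h → prodP (tabulate (branch e w h))) L
prodP-expand {m = zero}  u e w a u≋ = (1ℚ , []) ∷ [] , pointwise λ φ → refl
prodP-expand {n} {suc m} u e w a u≋ with prodP-expand (u ∘ suc) (e ∘ suc) (w ∘ suc) (a ∘ suc) (u≋ ∘ suc)
-- The leading factor contributes `e zero` to the first half and `w zero` to the second; only the
-- second half acquires the scalar `a zero`.
... | L , ih = extend true L ++ map (λ t → a zero ℚ.* proj₁ t , proj₂ t) (extend false L) , eq
  where
  extend : Bool → List (ℚ × Vec Bool m) → List (ℚ × Vec Bool (suc m))
  extend b = map (λ t → proj₁ t , b ∷ proj₂ t)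
  P : Vec Bool (suc m) → Poly n
  P h = prodP (tabulate (branch e w h))
  P′ : Vec Bool m → Poly n
  P′ h = prodP (tabulate (branch (e ∘ suc) (w ∘ suc) h))
  u₀ = u zero
  e₀ = e zero
  w₀ = w zero
  side : ∀ b q → (∀ h → q *ₚ P′ h ≋ P (b ∷ h)) → ∀ φ →
    eval q (λ α → eval (lincomb P′ L) (λ β → φ (α ∙ β))) ≡ eval (lincomb P (extend b L)) φ
  side b q q≋ φ = begin
    eval q (λ α → eval (lincomb P′ L) (λ β → φ (α ∙ β)))  ≡⟨ eval-* q (lincomb P′ L) φ ⟨
    eval (q *ₚ lincomb P′ L) φ                            ≡⟨ *ₚ-lincomb q P′ L .at φ ⟩
    eval (lincomb (λ h → q *ₚ P′ h) L) φ                  ≡⟨ lincomb-cong {Q = P} (b ∷_) q≋ L .at φ ⟩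
    eval (lincomb P (extend b L)) φ                       ∎
  eq : prodP (tabulate u) ≋ lincomb P (extend true L ++ map (λ t → a zero ℚ.* proj₁ t , proj₂ t) (extend false L))
  eq .at φ = begin
    eval (u₀ *ₚ prodP (tabulate (u ∘ suc))) φ
      ≡⟨ *ₚ-cong (u≋ zero) ih .at φ ⟩
    eval ((e₀ +ₚ scaleP (a zero) w₀) *ₚ lincomb P′ L) φ
      ≡⟨ eval-* (e₀ +ₚ scaleP (a zero) w₀) (lincomb P′ L) φ ⟩
    eval (e₀ +ₚ scaleP (a zero) w₀) ψ
      ≡⟨ trans (eval-++ e₀ _ ψ) (cong (eval e₀ ψ ℚ.+_) (eval-scale (a zero) w₀ ψ)) ⟩
    eval e₀ ψ ℚ.+ a zero ℚ.* eval w₀ ψ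
      ≡⟨ cong₂ (λ x y → x ℚ.+ a zero ℚ.* y) (side true e₀ (λ _ → ≋-refl) φ) (side false w₀ (λ _ → ≋-refl) φ) ⟩
    eval (lincomb P (extend true L)) φ ℚ.+ a zero ℚ.* eval (lincomb P (extend false L)) φ
      ≡⟨ cong (eval (lincomb P (extend true L)) φ ℚ.+_) (lincomb-scale P (a zero) (extend false L) φ) ⟨
    eval (lincomb P (extend true L)) φ ℚ.+ eval (lincomb P (map _ (extend false L))) φ
      ≡⟨ lincomb-++ P (extend true L) _ φ ⟨
    eval (lincomb P (extend true L ++ map _ (extend false L))) φ ∎
    where
    ψ : Monomial n → ℚ
    ψ α = eval (lincomb P′ L) (λ β → φ (α ∙ β))

pick : ∀ {A : Set} {m} → (Fin m → A) → Vec Bool m → List A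
pick e []          = []
pick e (true  ∷ h) = e zero ∷ pick (e ∘ suc) h
pick e (false ∷ h) = pick (e ∘ suc) h

-- Sorts the factors so that those from `e` precede those from `w`, matching the order of the
-- columns, where the spokes precede the tree edges.
prodP-branch : ∀ {n m} (e w : Fin m → Poly n) h →
  prodP (tabulate (branch e w h)) ≋ prodP (pick e h ++ pick w (Vec.map not h))
prodP-branch e w []          = ≋-refl
prodP-branch e w (true ∷ h)  = *ₚ-congˡ (e zero) (prodP-branch (e ∘ suc) (w ∘ suc) h)
prodP-branch e w (false ∷ h) = ≋-trans
  (*ₚ-congˡ (w zero) (prodP-branch (e ∘ suc) (w ∘ suc) h))
  (≋-sym (prodP-shift (pick (e ∘ suc) h) _ _))

-- Supports and coefficients

coeff-++ : ∀ {n} (p q : Poly n) α → coeff (p ++ q) α ≡ coeff p α ℚ.+ coeff q α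
coeff-++ p q α = begin
  coeff (p ++ q) α                                     ≡⟨ coeff-eval (p ++ q) α ⟩
  eval (p ++ q) (indicator α)                          ≡⟨ eval-++ p q (indicator α) ⟩
  eval p (indicator α) ℚ.+ eval q (indicator α)        ≡⟨ cong₂ ℚ._+_ (coeff-eval p α) (coeff-eval q α) ⟨
  coeff p α ℚ.+ coeff q α                              ∎

coeff-scale : ∀ {n} c (p : Poly n) α → coeff (scaleP c p) α ≡ c ℚ.* coeff p α
coeff-scale c p α = begin
  coeff (scaleP c p) α              ≡⟨ coeff-eval (scaleP c p) α ⟩
  eval (scaleP c p) (indicator α)   ≡⟨ eval-scale c p (indicator α) ⟩
  c ℚ.* eval p (indicator α)        ≡⟨ cong (c ℚ.*_) (coeff-eval p α) ⟨
  c ℚ.* coeff p α                   ∎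

coeff-mono-≡ : ∀ {n} (α : Monomial n) → coeff (mono α) α ≡ 1ℚ
coeff-mono-≡ α with VecP.≡-dec ℕ._≟_ α α
... | yes _  = refl
... | no α≢α = contradiction refl α≢α

coeff-mono-≢ : ∀ {n} {α β : Monomial n} → α ≢ β → coeff (mono α) β ≡ 0ℚ
coeff-mono-≢ {α = α} {β} α≢β with VecP.≡-dec ℕ._≟_ α β
... | yes α≡β = contradiction α≡β α≢β
... | no _    = refl

coeff-lincomb-∷ : ∀ {n} {H : Set} (P : H → Poly n) c h L α →
  coeff (lincomb P ((c , h) ∷ L)) α ≡ c ℚ.* coeff (P h) α ℚ.+ coeff (lincomb P L) α
coeff-lincomb-∷ P c h L α =
  trans (coeff-++ (scaleP c (P h)) (lincomb P L) α) (cong (ℚ._+ _) (coeff-scale c (P h) α))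

*-≢0 : ∀ {a b} → a ℚ.* b ≢ 0ℚ → a ≢ 0ℚ × b ≢ 0ℚ
*-≢0 {a} {b} ab≢0 =
  (λ a≡0 → ab≢0 (trans (cong (ℚ._* b) a≡0) (ℚP.*-zeroˡ b))) ,
  (λ b≡0 → ab≢0 (trans (cong (a ℚ.*_) b≡0) (ℚP.*-zeroʳ a)))

-- A sum that is nonzero at `α` has a summand that is nonzero there. The predicate `R` carries along
-- a side condition on the indices, later the full rank of the complement.
coeff-lincomb-≢0 : ∀ {n} {H : Set} (P : H → Poly n) {R : H → Set} L α →
  All (λ t → R (proj₂ t)) L → coeff (lincomb P L) α ≢ 0ℚ → ∃ λ h → R h × coeff (P h) α ≢ 0ℚ
coeff-lincomb-≢0 P []            α []       ≢0 = contradiction refl ≢0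
coeff-lincomb-≢0 P ((c , h) ∷ L) α (r ∷ rs) ≢0 with c ℚ.* coeff (P h) α ℚP.≟ 0ℚ
... | no  p = h , r , proj₂ (*-≢0 {c} p)
... | yes p = coeff-lincomb-≢0 P L α rs λ q →
  ≢0 (trans (coeff-lincomb-∷ P c h L α) (cong₂ ℚ._+_ p q))

coeff-≢0⇒∈ : ∀ {n} (f : Poly n) α → coeff f α ≢ 0ℚ → α ∈ map proj₂ f
coeff-≢0⇒∈ []            α ≢0 = contradiction refl ≢0
coeff-≢0⇒∈ ((c , β) ∷ f) α ≢0 with VecP.≡-dec ℕ._≟_ β α
... | yes refl = here refl
... | no _     = there (coeff-≢0⇒∈ f α ≢0)

-- The support is cleared monomial by monomial: if the head `μ` of the list has coefficient
-- `c ≢ 0ℚ`, it is some `M h`, and subtracting `c` times it leaves a polynomial supported on the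
-- tail.
expand-over : ∀ {n} {H : Set} (M : H → Monomial n) ms f →
  (∀ α → coeff f α ≢ 0ℚ → α ∈ ms) → (∀ α → coeff f α ≢ 0ℚ → ∃ λ h → M h ≡ α) →
  ∃ λ (L : List (ℚ × H)) → f ≈ₚ lincomb (mono ∘ M) L
expand-over M [] f supp hit =
  [] , λ α → decidable-stable (coeff f α ℚP.≟ 0ℚ) (λ ≢0 → contradiction (supp α ≢0) λ ())
expand-over M (μ ∷ ms) f supp hit with coeff f μ ℚP.≟ 0ℚ
... | yes ≡0 = expand-over M ms f supp′ hit
  where
  supp′ : ∀ α → coeff f α ≢ 0ℚ → α ∈ ms
  supp′ α ≢0 with supp α ≢0
  ... | here refl = contradiction ≡0 ≢0
  ... | there α∈  = α∈
... | no ≢0 with hit μ ≢0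
...   | h , refl = let L , f′≈L = expand-over M ms f′ supp′ hit′ in (c , h) ∷ L , eq L f′≈L
  where
  c = coeff f μ
  f′ = f ++ scaleP (ℚ.- c) (mono μ)
  coeff-f′ : ∀ α → coeff f′ α ≡ coeff f α ℚ.- c ℚ.* coeff (mono μ) α
  coeff-f′ α = trans (coeff-++ f _ α) (cong (coeff f α ℚ.+_)
    (trans (coeff-scale (ℚ.- c) (mono μ) α) (sym (ℚP.neg-distribˡ-* c _))))
  off : ∀ α → coeff f′ α ≢ 0ℚ → coeff f α ≢ 0ℚ × α ≢ μ
  off α f′≢0 with VecP.≡-dec ℕ._≟_ μ α
  ... | yes refl = contradiction (trans (coeff-f′ μ) (trans (cong (λ x → c ℚ.- c ℚ.* x) (coeff-mono-≡ μ))
          (solve 1 (λ c → c :- c :* con 1ℚ := con 0ℚ) refl c))) f′≢0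
  ... | no μ≢α   = (λ ≡0 → f′≢0 (trans (coeff-f′ α) (trans (cong₂ (λ x y → x ℚ.- c ℚ.* y) ≡0 (coeff-mono-≢ μ≢α))
          (solve 1 (λ c → con 0ℚ :- c :* con 0ℚ := con 0ℚ) refl c)))) , μ≢α ∘ sym
  supp′ : ∀ α → coeff f′ α ≢ 0ℚ → α ∈ ms
  supp′ α f′≢0 with supp α (proj₁ (off α f′≢0))
  ... | here α≡μ = contradiction α≡μ (proj₂ (off α f′≢0))
  ... | there α∈ = α∈
  hit′ : ∀ α → coeff f′ α ≢ 0ℚ → ∃ λ h → M h ≡ α
  hit′ α f′≢0 = hit α (proj₁ (off α f′≢0))
  eq : ∀ L → f′ ≈ₚ lincomb (mono ∘ M) L → f ≈ₚ lincomb (mono ∘ M) ((c , h) ∷ L)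
  eq L f′≈L α = begin
    coeff f α
      ≡⟨ solve 2 (λ x y → x := y :+ (x :- y)) refl (coeff f α) (c ℚ.* coeff (mono μ) α) ⟩
    c ℚ.* coeff (mono μ) α ℚ.+ (coeff f α ℚ.- c ℚ.* coeff (mono μ) α)  ≡⟨ cong (c ℚ.* coeff (mono μ) α ℚ.+_) (trans (sym (coeff-f′ α)) (f′≈L α)) ⟩
    c ℚ.* coeff (mono μ) α ℚ.+ coeff (lincomb (mono ∘ M) L) α          ≡⟨ coeff-lincomb-∷ (mono ∘ M) c h L α ⟨
    coeff (lincomb (mono ∘ M) ((c , h) ∷ L)) α                         ∎

lincomb-mono-fresh : ∀ {n} {H : Set} (M : H → Monomial n) μ L →
  All (λ t → M (proj₂ t) ≢ μ) L → coeff (lincomb (mono ∘ M) L) μ ≡ 0ℚ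
lincomb-mono-fresh M μ []            []       = refl
lincomb-mono-fresh M μ ((c , h) ∷ L) (≢μ ∷ r) = begin
  coeff (lincomb (mono ∘ M) ((c , h) ∷ L)) μ                       ≡⟨ coeff-lincomb-∷ (mono ∘ M) c h L μ ⟩
  c ℚ.* coeff (mono (M h)) μ ℚ.+ coeff (lincomb (mono ∘ M) L) μ    ≡⟨ cong₂ (λ x y → c ℚ.* x ℚ.+ y) (coeff-mono-≢ ≢μ) (lincomb-mono-fresh M μ L r) ⟩
  c ℚ.* 0ℚ ℚ.+ 0ℚ                                                  ≡⟨ solve 1 (λ c → c :* con 0ℚ :+ con 0ℚ := con 0ℚ) refl c ⟩
  0ℚ                                                               ∎

-- Distinct keys force distinct monomials, so the coefficient at `M h` sees only the first term.
-- Keys are compared instead of indices because a `SignVec` also contains a proof, while uniqueness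
-- concerns the underlying vector.
mono-independent : ∀ {n} {H K : Set} (M : H → Monomial n) (key : H → K) →
  (∀ {h h′} → M h ≡ M h′ → key h ≡ key h′) →
  ∀ L → Unique (map (λ t → key (proj₂ t)) L) → lincomb (mono ∘ M) L ≈ₚ zeroP →
  All (λ t → proj₁ t ≡ 0ℚ) L
mono-independent M key inj []            _          _  = []
mono-independent M key inj ((c , h) ∷ L) (new ∷ un) ≈0 =
  c≡0 ∷ mono-independent M key inj L un L≈0
  where
  fresh : ∀ L → All (key h ≢_) (map (λ t → key (proj₂ t)) L) → All (λ t → M (proj₂ t) ≢ M h) L
  fresh []      []       = []
  fresh (t ∷ L) (k ∷ ks) = (λ e → k (sym (inj e))) ∷ fresh L ks
  c≡0 : c ≡ 0ℚ
  c≡0 = begin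
    c                                                    ≡⟨ solve 1 (λ c → c := c :* con 1ℚ :+ con 0ℚ) refl c ⟩
    c ℚ.* 1ℚ ℚ.+ 0ℚ                                      ≡⟨ cong₂ (λ x y → c ℚ.* x ℚ.+ y) (coeff-mono-≡ (M h)) (lincomb-mono-fresh M (M h) L (fresh L new)) ⟨
    c ℚ.* coeff (mono (M h)) (M h) ℚ.+ coeff (lincomb (mono ∘ M) L) (M h) ≡⟨ coeff-lincomb-∷ (mono ∘ M) c h L (M h) ⟨
    coeff (lincomb (mono ∘ M) ((c , h) ∷ L)) (M h)       ≡⟨ ≈0 (M h) ⟩
    0ℚ                                                   ∎
  L≈0 : lincomb (mono ∘ M) L ≈ₚ zeroP
  L≈0 α = begin
    coeff (lincomb (mono ∘ M) L) α                                     ≡⟨ solve 2 (λ x y → x  := con 0ℚ :* y :+ x) refl (coeff (lincomb (mono ∘ M) L) α) (coeff (mono (M h)) α) ⟩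
    0ℚ ℚ.* coeff (mono (M h)) α ℚ.+ coeff (lincomb (mono ∘ M) L) α     ≡⟨ cong (λ x → x ℚ.* coeff (mono (M h)) α ℚ.+ coeff (lincomb (mono ∘ M) L) α) c≡0 ⟨
    c ℚ.* coeff (mono (M h)) α ℚ.+ coeff (lincomb (mono ∘ M) L) α      ≡⟨ coeff-lincomb-∷ (mono ∘ M) c h L α ⟨
    coeff (lincomb (mono ∘ M) ((c , h) ∷ L)) α                         ≡⟨ ≈0 α ⟩
    0ℚ                                                                 ∎

-- Spanning lists of vectors and transversals

evec-≡ : ∀ {n} (j : Fin n) → evec (suc j) j ≡ 1ℚ
evec-≡ j with j ≟ᶠ j
... | yes _  = refl
... | no j≢j = contradiction refl j≢j

evec-≢ : ∀ {n} {j i : Fin n} → j ≢ i → evec (suc j) i ≡ 0ℚ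
evec-≢ {j = j} {i} j≢i with j ≟ᶠ i
... | yes j≡i = contradiction j≡i j≢i
... | no _    = refl

-- v lies in the span of S up to its coordinates in D.
SpanOff : ∀ {n} → List (Fin n) → List (Vector n) → Vector n → Set
SpanOff D []      v = ∀ i → i ∉ D → v i ≡ 0ℚ
SpanOff D (b ∷ S) v = ∃ λ c → SpanOff D S (λ i → v i ℚ.- c ℚ.* b i)

module _ {n : ℕ} {D : List (Fin n)} where

  span-resp : ∀ S {v w : Vector n} → (∀ i → i ∉ D → v i ≡ w i) → SpanOff D S v → SpanOff D S w
  span-resp []      e s       i i∉ = trans (sym (e i i∉)) (s i i∉)
  span-resp (b ∷ S) e (c , s) = c , span-resp S (λ i i∉ → cong (ℚ._- c ℚ.* b i) (e i i∉)) s

  span-+ : ∀ S {v w : Vector n} a → SpanOff D S v → SpanOff D S w → SpanOff D S (λ i → v i ℚ.+ a ℚ.* w i)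
  span-+ []      a s t i i∉ rewrite s i i∉ | t i i∉ = solve 1 (λ a → con 0ℚ :+ a :* con 0ℚ := con 0ℚ) refl a
  span-+ (b ∷ S) {v} {w} a (c , s) (d , t) = c ℚ.+ a ℚ.* d , span-resp S
    (λ i _ → solve 6 (λ v w a b c d → (v :- c :* b) :+ a :* (w :- d :* b) := (v :+ a :* w) :- (c :+ a :* d) :* b)
      refl (v i) (w i) a (b i) c d)
    (span-+ S a s t)

  span-zero : ∀ S → SpanOff D S (λ _ → 0ℚ)
  span-zero []      i _ = refl
  span-zero (b ∷ S) = 0ℚ , span-resp S
    (λ i _ → solve 1 (λ b → con 0ℚ := con 0ℚ :- con 0ℚ :* b) refl (b i)) (span-zero S)

  span-weaken : ∀ S {v : Vector n} {j} → SpanOff D S v → SpanOff (j ∷ D) S v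
  span-weaken []      s       i i∉ = s i (i∉ ∘ there)
  span-weaken (b ∷ S) (c , s) = c , span-weaken S s

  span-there : ∀ {b} S {v : Vector n} → SpanOff D S v → SpanOff D (b ∷ S) v
  span-there {b} S {v} s = 0ℚ , span-resp S (λ i _ → solve 2 (λ v b → v := v :- con 0ℚ :* b) refl (v i) (b i)) s

  -- The multiple of `b` used for `v` is replaced by the same multiple of an expression of `b` in
  -- `S`.
  span-drop : ∀ {b} S {v : Vector n} → SpanOff D S b → SpanOff D (b ∷ S) v → SpanOff D S v
  span-drop {b} S {v} sb (c , s) = span-resp S
    (λ i _ → solve 3 (λ v c b → (v :- c :* b) :+ c :* b := v) refl (v i) c (b i)) (span-+ S c s sb)

  span-∈ : ∀ {S} {v : Vector n} → v ∈ S → SpanOff D S v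
  span-∈ {S = v ∷ S} (here refl) = 1ℚ , span-resp S
    (λ i _ → solve 1 (λ v → con 0ℚ := v :- con 1ℚ :* v) refl (v i)) (span-zero S)
  span-∈ {S = b ∷ S} (there v∈S) = span-there S (span-∈ v∈S)

  -- Write `v` as the sum of its coordinates times unit vectors and remove one coordinate at a time.
  -- A unit vector has to be available only where the coordinate is nonzero.
  span-from-units : ∀ S (v : Vector n) →
    (∀ j → j ∉ D → v j ≡ 0ℚ ⊎ SpanOff D S (evec (suc j))) → SpanOff D S v
  span-from-units S v = go (allFin n) v (λ i i∉ _ → contradiction (∈-allFin i) i∉)
    where
    -- Invariant: off `D`, the remaining vector vanishes outside `js`.
    go : ∀ js (v : Vector n) → (∀ i → i ∉ js → i ∉ D → v i ≡ 0ℚ) →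
      (∀ j → j ∉ D → v j ≡ 0ℚ ⊎ SpanOff D S (evec (suc j))) → SpanOff D S v
    go []       v off units = span-resp S (λ i i∉D → sym (off i (λ ()) i∉D)) (span-zero S)
    go (j ∷ js) v off units = cases (j ∈? D)
      where
      skip : (j ∉ D → v j ≡ 0ℚ) → SpanOff D S v
      skip vj≡0 = go js v off′ units
        where
        off′ : ∀ i → i ∉ js → i ∉ D → v i ≡ 0ℚ
        off′ i i∉js i∉D with i ≟ᶠ j
        ... | yes refl = vj≡0 i∉D
        ... | no i≢j   = off i (λ { (here i≡j) → i≢j i≡j ; (there i∈) → i∉js i∈ }) i∉D
      cases : Dec (j ∈ D) → SpanOff D S v
      cases (yes j∈D) = skip (λ j∉D → contradiction j∈D j∉D)
      cases (no j∉D) with units j j∉D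
      ... | inj₁ vj≡0 = skip (λ _ → vj≡0)
      ... | inj₂ se   = span-resp S
        (λ i _ → solve 3 (λ v c e → (v :- c :* e) :+ c :* e := v) refl (v i) (v j) (evec (suc j) i))
        (span-+ S (v j) (go js v′ off′ units′) se)
        where
        v′ : Vector n
        v′ i = v i ℚ.- v j ℚ.* evec (suc j) i
        v′j≡0 : v′ j ≡ 0ℚ
        v′j≡0 rewrite evec-≡ j = solve 1 (λ v → v :- v :* con 1ℚ := con 0ℚ) refl (v j)
        v′i≡vi : ∀ {i} → i ≢ j → v′ i ≡ v i
        v′i≡vi {i} i≢j rewrite evec-≢ (i≢j ∘ sym) =
          solve 2 (λ v c → v :- c :* con 0ℚ := v) refl (v i) (v j)
        off′ : ∀ i → i ∉ js → i ∉ D → v′ i ≡ 0ℚ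
        off′ i i∉js i∉D with i ≟ᶠ j
        ... | yes refl = v′j≡0
        ... | no i≢j   = trans (v′i≡vi i≢j)
          (off i (λ { (here i≡j) → i≢j i≡j ; (there i∈) → i∉js i∈ }) i∉D)
        units′ : ∀ i → i ∉ D → v′ i ≡ 0ℚ ⊎ SpanOff D S (evec (suc i))
        units′ i i∉D with i ≟ᶠ j
        ... | yes refl = inj₁ v′j≡0
        ... | no i≢j with units i i∉D
        ...   | inj₁ vi≡0 = inj₁ (trans (v′i≡vi i≢j) vi≡0)
        ...   | inj₂ s    = inj₂ s

-- `FullRank` leaves the length of the coefficient list open. As `zipWith` truncates, surplus
-- coefficients are ignored and missing ones count as zero.
combination⇒span : ∀ {n} (S : List (Vector n)) cs {v} →
  (∀ i → v i ≡ sumℚ (zipWith (λ c s → c ℚ.* s i) cs S)) → SpanOff [] S v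
combination⇒span []      []       e i _ = e i
combination⇒span []      (c ∷ cs) e i _ = e i
combination⇒span (b ∷ S) []       e = span-resp (b ∷ S) (λ i _ → sym (e i)) (span-zero (b ∷ S))
combination⇒span (b ∷ S) (c ∷ cs) {v} e = c , combination⇒span S cs λ i →
  trans (cong (ℚ._- c ℚ.* b i) (e i))
    (solve 2 (λ x y → (x :+ y) :- x := y) refl (c ℚ.* b i) (sumℚ (zipWith (λ c s → c ℚ.* s i) cs S)))

span⇒combination : ∀ {n} (S : List (Vector n)) {v} → SpanOff [] S v →
  ∃ λ cs → ∀ i → v i ≡ sumℚ (zipWith (λ c s → c ℚ.* s i) cs S)
span⇒combination []      s = [] , λ i → s i (λ ())
span⇒combination (b ∷ S) {v} (c , s) with span⇒combination S s
... | cs , e = c ∷ cs , λ i → trans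
  (solve 2 (λ v x → v := x :+ (v :- x)) refl (v i) (c ℚ.* b i)) (cong (c ℚ.* b i ℚ.+_) (e i))

Nonzero : ∀ {n} → Vector n → Fin n → Set
Nonzero b i = b i ≢ 0ℚ

-- If S and b span, write c j for the coefficient of b in the unit vector j.  When some j has
-- b j ≠ 0 ≠ c j, the vector b is traded for the unit vector j (Laplace expansion without
-- determinants); otherwise every unit vector occurring in b is already spanned by S, and so is b.
transversal : ∀ {n} (D : List (Fin n)) S → (∀ v → SpanOff D S v) →
  ∃ λ S′ → ∃ λ cs → S′ ⊆ S × Pointwise Nonzero S′ cs × (∀ i → i ∈ cs ⊎ i ∈ D)
transversal {n} D [] spans = [] , [] , [] , [] , covered
  where
  covered : ∀ i → i ∈ [] ⊎ i ∈ D
  covered i with i ∈? D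
  ... | yes i∈D = inj₂ i∈D
  -- With no vectors left, an uncovered coordinate `i` would make its own unit vector vanish there,
  -- giving 1 = 0.
  ... | no i∉D  = contradiction (trans (sym (evec-≡ i)) (spans (evec (suc i)) i i∉D)) λ ()
transversal {n} D (b ∷ S) spans with any? (λ j → ¬? (j ∈? D) ×-dec ¬? (b j ℚP.≟ 0ℚ) ×-dec ¬? (proj₁ (spans (evec (suc j))) ℚP.≟ 0ℚ))
... | yes (j , j∉D , bj≢0 , c≢0) =
  let S′ , cs , S′⊆S , nz , cover = transversal (j ∷ D) S spans′
  in b ∷ S′ , j ∷ cs , refl ∷ S′⊆S , bj≢0 ∷ nz , λ i → move (cover i)
  where
  c = proj₁ (spans (evec (suc j)))
  instance
    c-nonZero : ℚ.NonZero c
    c-nonZero = ℚ.≢-nonZero c≢0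
  -- Once coordinate `j` is ignored, its unit vector counts as zero; `S` spans that vector minus `c`
  -- times `b`, and dividing by `- c` gives `b`.
  recover : ∀ i → i ∉ j ∷ D → 0ℚ ℚ.+ (ℚ.- (ℚ.1/ c)) ℚ.* (evec (suc j) i ℚ.- c ℚ.* b i) ≡ b i
  recover i i∉ rewrite evec-≢ {j = j} {i} (λ { refl → i∉ (here refl) }) = begin
    0ℚ ℚ.+ (ℚ.- (ℚ.1/ c)) ℚ.* (0ℚ ℚ.- c ℚ.* b i)
      ≡⟨ solve 3 (λ c d b → con 0ℚ :+ (:- d) :* (con 0ℚ :- c :* b) := (c :* d) :* b) refl c (ℚ.1/ c) (b i) ⟩
    (c ℚ.* ℚ.1/ c) ℚ.* b i   ≡⟨ cong (ℚ._* b i) (ℚP.*-inverseʳ c) ⟩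
    1ℚ ℚ.* b i               ≡⟨ ℚP.*-identityˡ (b i) ⟩
    b i                      ∎
  b-spanned : SpanOff (j ∷ D) S b
  b-spanned = span-resp S recover
    (span-+ S (ℚ.- (ℚ.1/ c)) (span-zero S) (span-weaken S (proj₂ (spans (evec (suc j))))))
  spans′ : ∀ v → SpanOff (j ∷ D) S v
  spans′ v = span-drop S b-spanned (span-weaken (b ∷ S) {v} (spans v))
  move : ∀ {i cs} → i ∈ cs ⊎ i ∈ j ∷ D → i ∈ j ∷ cs ⊎ i ∈ D
  move (inj₁ i∈)         = inj₁ (there i∈)
  move (inj₂ (here i≡j)) = inj₁ (here i≡j)
  move (inj₂ (there i∈)) = inj₂ i∈
... | no none =
  let S′ , cs , S′⊆S , rest = transversal D S (λ v → span-drop S b-spanned (spans v))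
  in S′ , cs , b ∷ʳ S′⊆S , rest
  where
  units : ∀ j → j ∉ D → b j ≡ 0ℚ ⊎ SpanOff D S (evec (suc j))
  units j j∉D with b j ℚP.≟ 0ℚ
  ... | yes bj≡0 = inj₁ bj≡0
  ... | no bj≢0  = inj₂ (span-resp S (λ i _ → trans (cong (λ c → evec (suc j) i ℚ.- c ℚ.* b i) c≡0)
          (solve 2 (λ e b → e :- con 0ℚ :* b := e) refl (evec (suc j) i) (b i))) (proj₂ (spans (evec (suc j)))))
    where
    c≡0 = decidable-stable (proj₁ (spans (evec (suc j))) ℚP.≟ 0ℚ) (λ c≢0 → none (j , j∉D , bj≢0 , c≢0))
  b-spanned : SpanOff D S b
  b-spanned = span-from-units S b units

-- Occurrence counts

-- The exponent of the variable with index `v` in the variable with index `c`, written as in `linP`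
-- so that the exponent vectors agree by computation.
δ : ∀ {n} → Fin n → Fin n → ℕ
δ c v = if ⌊ c ≟ᶠ v ⌋ then 1 else 0

occ : ∀ {n} → List (Fin n) → Fin n → ℕ
occ []       v = 0
occ (c ∷ cs) v = δ c v ℕ.+ occ cs v

δ-≡ : ∀ {n} (v : Fin n) → δ v v ≡ 1
δ-≡ v with v ≟ᶠ v
... | yes _  = refl
... | no v≢v = contradiction refl v≢v

δ-≢ : ∀ {n} {c v : Fin n} → c ≢ v → δ c v ≡ 0
δ-≢ {c = c} {v} c≢v with c ≟ᶠ v
... | yes c≡v = contradiction c≡v c≢v
... | no _    = refl

δ-suc : ∀ {n} (c v : Fin n) → δ (suc c) (suc v) ≡ δ c v
δ-suc c v with c ≟ᶠ v
... | yes _ = refl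
... | no _  = refl

occ-++ : ∀ {n} cs ds (v : Fin n) → occ (cs ++ ds) v ≡ occ cs v ℕ.+ occ ds v
occ-++ []       ds v = refl
occ-++ (c ∷ cs) ds v = trans (cong (δ c v ℕ.+_) (occ-++ cs ds v)) (sym (ℕP.+-assoc (δ c v) _ _))

∈⇒occ≥1 : ∀ {n} {cs} {v : Fin n} → v ∈ cs → 1 ≤ occ cs v
∈⇒occ≥1 {cs = v ∷ cs} (here refl) rewrite δ-≡ v = s≤s z≤n
∈⇒occ≥1 {cs = c ∷ cs} {v} (there v∈) = ℕP.≤-trans (∈⇒occ≥1 v∈) (ℕP.m≤n+m (occ cs v) (δ c v))

sum-tabulate-+ : ∀ {n} (f g : Fin n → ℕ) →
  Vec.sum (Vec.tabulate (λ i → f i ℕ.+ g i)) ≡ Vec.sum (Vec.tabulate f) ℕ.+ Vec.sum (Vec.tabulate g)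
sum-tabulate-+ {zero}  f g = refl
sum-tabulate-+ {suc n} f g = trans (cong (f zero ℕ.+ g zero ℕ.+_) (sum-tabulate-+ (f ∘ suc) (g ∘ suc)))
  (interchange ℕP.+-commutativeSemigroup (f zero) (g zero) _ _)

sum-tabulate-0 : ∀ n → Vec.sum (Vec.tabulate {n = n} (λ _ → 0)) ≡ 0
sum-tabulate-0 zero    = refl
sum-tabulate-0 (suc n) = sum-tabulate-0 n

sum-δ : ∀ {n} (c : Fin n) → Vec.sum (Vec.tabulate (δ c)) ≡ 1
sum-δ {suc n} zero    = cong suc (sum-tabulate-0 n)
sum-δ {suc n} (suc c) = trans (cong Vec.sum (VecP.tabulate-cong (δ-suc c))) (sum-δ c)

sum-occ : ∀ {n} (cs : List (Fin n)) → Vec.sum (Vec.tabulate (occ cs)) ≡ length cs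
sum-occ {n} []   = sum-tabulate-0 n
sum-occ (c ∷ cs) = trans (sum-tabulate-+ (δ c) (occ cs)) (cong₂ ℕ._+_ (sum-δ c) (sum-occ cs))

n≤sum : ∀ {n} (f : Fin n → ℕ) → (∀ i → 1 ≤ f i) → n ≤ Vec.sum (Vec.tabulate f)
n≤sum {zero}  f f≥1 = z≤n
n≤sum {suc n} f f≥1 = ℕP.+-mono-≤ (f≥1 zero) (n≤sum (f ∘ suc) (f≥1 ∘ suc))

-- Positive entries already use up a total of `n`, so no entry has room to exceed 1.
sum≤n⇒≡1 : ∀ {n} (f : Fin n → ℕ) → (∀ i → 1 ≤ f i) → Vec.sum (Vec.tabulate f) ≤ n → ∀ i → f i ≡ 1
sum≤n⇒≡1 {suc n} f f≥1 ≤n zero = ℕP.≤-antisym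
  (ℕP.+-cancelʳ-≤ n (f zero) 1 (ℕP.≤-trans (ℕP.+-monoʳ-≤ (f zero) (n≤sum (f ∘ suc) (f≥1 ∘ suc))) ≤n)) (f≥1 zero)
sum≤n⇒≡1 {suc n} f f≥1 ≤n (suc i) = sum≤n⇒≡1 (f ∘ suc) (f≥1 ∘ suc)
  (ℕP.+-cancelˡ-≤ 1 _ n (ℕP.≤-trans (ℕP.+-monoˡ-≤ _ (f≥1 zero)) ≤n)) i

covering⇒occ≡1 : ∀ {n} (cs : List (Fin n)) → (∀ i → i ∈ cs) → length cs ≤ n → ∀ i → occ cs i ≡ 1
covering⇒occ≡1 {n} cs cover len =
  sum≤n⇒≡1 (occ cs) (λ i → ∈⇒occ≥1 (cover i)) (subst (_≤ n) (sym (sum-occ cs)) len)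

covering⇒n≤length : ∀ {n} (cs : List (Fin n)) → (∀ i → i ∈ cs) → n ≤ length cs
covering⇒n≤length {n} cs cover = subst (n ≤_) (sum-occ cs) (n≤sum (occ cs) (λ i → ∈⇒occ≥1 (cover i)))

occ-allFin : ∀ n v → occ (allFin n) v ≡ 1
occ-allFin n = covering⇒occ≡1 (allFin n) ∈-allFin (ℕP.≤-reflexive (ListP.length-tabulate {n = n} id))

occ-tabulate-≤ : ∀ {n l} (z z′ : Fin l → Fin n) v → (∀ j → z′ j ≡ v → z j ≡ v) →
  occ (tabulate z′) v ≤ occ (tabulate z) v
occ-tabulate-≤ {l = zero}  z z′ v imp = z≤n
occ-tabulate-≤ {l = suc l} z z′ v imp = ℕP.+-mono-≤ δ-≤ (occ-tabulate-≤ (z ∘ suc) (z′ ∘ suc) v (imp ∘ suc))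
  where
  δ-≤ : δ (z′ zero) v ≤ δ (z zero) v
  δ-≤ with z′ zero ≟ᶠ v
  ... | no _ = z≤n
  ... | yes e rewrite imp zero e | δ-≡ v = s≤s z≤n

-- Strictness comes from the index `i`, counted for `z` but not for `z′`; every other index obeys
-- the weak inequality. This compares the indegrees of two orientations at a vertex.
occ-tabulate-< : ∀ {n l} (z z′ : Fin l → Fin n) v → (∀ j → z′ j ≡ v → z j ≡ v) →
  ∀ i → z i ≡ v → z′ i ≢ v → occ (tabulate z′) v < occ (tabulate z) v
occ-tabulate-< z z′ v imp zero zi z′i rewrite zi | δ-≡ v | δ-≢ z′i =
  s≤s (occ-tabulate-≤ (z ∘ suc) (z′ ∘ suc) v (imp ∘ suc))
occ-tabulate-< z z′ v imp (suc i) zi z′i = ℕP.+-mono-≤-<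
  -- The comparison of the two leading entries is the weak inequality for one-element families, with
  -- the trailing `+ 0` removed.
  (subst₂ _≤_ (ℕP.+-identityʳ _) (ℕP.+-identityʳ _) (occ-tabulate-≤ {l = 1} (λ _ → z zero) (λ _ → z′ zero) v (λ _ → imp zero)))
  (occ-tabulate-< (z ∘ suc) (z′ ∘ suc) v (imp ∘ suc) i zi z′i)

-- A transversal covers `n` coordinates and so uses at least `n` vectors; `B` has only `n`. Hence
-- the sublist is all of `B`, and no coordinate is repeated.
basis-transversal : ∀ {n} (B : List (Vector n)) → length B ≡ n → FullRank B →
  ∃ λ cs → Pointwise Nonzero B cs × (∀ v → occ cs v ≡ 1)
basis-transversal {n} B len full with transversal [] B (λ v → combination⇒span B (proj₁ (full v)) (proj₂ (full v)))
... | S′ , cs , S′⊆B , nz , cover = cs , subst (λ S → Pointwise Nonzero S cs) S′≡B nz , covering⇒occ≡1 cs cover′ cs≤n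
  where
  cover′ : ∀ i → i ∈ cs
  cover′ i with cover i
  ... | inj₁ i∈ = i∈
  S′≤B = length-mono-≤ S′⊆B
  cs≤n : length cs ≤ n
  cs≤n = subst₂ _≤_ (PW.Pointwise-length nz) len S′≤B
  S′≡B : S′ ≡ B
  S′≡B = PW.Pointwise-≡⇒≡ (toPointwise (ℕP.≤-antisym S′≤B
    (subst₂ _≤_ (sym len) (sym (PW.Pointwise-length nz)) (covering⇒n≤length cs cover′))) S′⊆B)

-- Monomials of a product of linear forms

tabulate-∙ : ∀ {n} (f g : Fin n → ℕ) → Vec.tabulate f ∙ Vec.tabulate g ≡ Vec.tabulate (λ i → f i ℕ.+ g i)
tabulate-∙ {zero}  f g = refl
tabulate-∙ {suc n} f g = cong (f zero ℕ.+ g zero ∷_) (tabulate-∙ (f ∘ suc) (g ∘ suc))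

replicate-tabulate : ∀ n → Vec.replicate n 0 ≡ Vec.tabulate (λ _ → 0)
replicate-tabulate zero    = refl
replicate-tabulate (suc n) = cong (0 ∷_) (replicate-tabulate n)

-- Terms with coefficient zero are exempt, because `linP` lists a term for every coordinate,
-- including those where the vector vanishes.
Supported : ∀ {n} → (Monomial n → Set) → ℚ × Monomial n → Set
Supported Q t = proj₁ t ≡ 0ℚ ⊎ Q (proj₂ t)

coeff-supported : ∀ {n} {Q : Monomial n → Set} p α → All (Supported Q) p → coeff p α ≢ 0ℚ → Q α
coeff-supported []            α []       ≢0 = contradiction refl ≢0
coeff-supported ((c , β) ∷ p) α (q ∷ qs) ≢0 with VecP.≡-dec ℕ._≟_ β α
... | no _ = coeff-supported p α qs ≢0
coeff-supported ((c , β) ∷ p) α (inj₂ q ∷ qs) ≢0    | yes refl = q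
coeff-supported ((c , β) ∷ p) α (inj₁ refl ∷ qs) ≢0 | yes refl =
  coeff-supported p α qs (λ e → ≢0 (trans (ℚP.+-identityˡ _) e))

*ₚ-supported : ∀ {n} {P Q R : Monomial n → Set} → (∀ {α β} → P α → Q β → R (α ∙ β)) →
  ∀ {p q} → All (Supported P) p → All (Supported Q) q → All (Supported R) (p *ₚ q)
*ₚ-supported mul []       bs = []
*ₚ-supported {P = P} {Q} {R} mul {p = (c , α) ∷ p} (a ∷ as) bs =
  AllP.++⁺ (AllP.map⁺ (All.map (both a) bs)) (*ₚ-supported mul as bs)
  where
  both : Supported P (c , α) → ∀ {t} → Supported Q t → Supported R (c ℚ.* proj₁ t , α ∙ proj₂ t)
  both (inj₁ refl) {t} _         = inj₁ (ℚP.*-zeroˡ (proj₁ t))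
  both (inj₂ a) (inj₁ refl)      = inj₁ (ℚP.*-zeroʳ c)
  both (inj₂ a) (inj₂ b)         = inj₂ (mul a b)

linP-supported : ∀ {n} (x : Vector n) →
  All (Supported (λ α → ∃ λ i → Nonzero x i × α ≡ Vec.tabulate (δ i))) (linP x)
linP-supported {n} x = AllP.map⁺ (All.universal term (allFin n))
  where
  term : ∀ i → Supported (λ α → ∃ λ i → Nonzero x i × α ≡ Vec.tabulate (δ i)) (x i , Vec.tabulate (δ i))
  term i with x i ℚP.≟ 0ℚ
  ... | yes xi≡0 = inj₁ xi≡0
  ... | no xi≢0  = inj₂ (i , xi≢0 , refl)

-- Multiplying out a product of linear forms picks one nonzero coordinate of each vector; the
-- exponents count how often each coordinate is picked.
Transversal : ∀ {n} → List (Vector n) → Monomial n → Set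
Transversal R α = ∃ λ cs → Pointwise Nonzero R cs × α ≡ Vec.tabulate (occ cs)

pR-supported : ∀ {n} (R : List (Vector n)) → All (Supported (Transversal R)) (pR R)
pR-supported {n} []      = inj₂ ([] , [] , replicate-tabulate n) ∷ []
pR-supported     (x ∷ R) = *ₚ-supported
  (λ { (i , nz , refl) (cs , nzs , refl) → i ∷ cs , nz ∷ nzs , tabulate-∙ (δ i) (occ cs) })
  (linP-supported x) (pR-supported R)

mono-occ-∷ : ∀ {n} (c : Fin n) cs →
  mono (Vec.tabulate (occ (c ∷ cs))) ≋ mono (Vec.tabulate (δ c)) *ₚ mono (Vec.tabulate (occ cs))
mono-occ-∷ c cs .at φ = begin
  1ℚ ℚ.* φ (Vec.tabulate (occ (c ∷ cs))) ℚ.+ 0ℚ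
    ≡⟨ cong (λ α → 1ℚ ℚ.* φ α ℚ.+ 0ℚ) (tabulate-∙ (δ c) (occ cs)) ⟨
  1ℚ ℚ.* φ αβ ℚ.+ 0ℚ
    ≡⟨ solve 1 (λ x → con 1ℚ :* x :+ con 0ℚ := con 1ℚ :* (con 1ℚ :* x :+ con 0ℚ) :+ con 0ℚ) refl (φ αβ) ⟩
  1ℚ ℚ.* (1ℚ ℚ.* φ αβ ℚ.+ 0ℚ) ℚ.+ 0ℚ
    ≡⟨ eval-* (mono (Vec.tabulate (δ c))) (mono (Vec.tabulate (occ cs))) φ ⟨
  eval (mono (Vec.tabulate (δ c)) *ₚ mono (Vec.tabulate (occ cs))) φ ∎
  where αβ = Vec.tabulate (δ c) ∙ Vec.tabulate (occ cs)

mono-occ : ∀ {n l} (z : Fin l → Fin n) →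
  mono (Vec.tabulate (occ (tabulate z))) ≋ prodP (tabulate (λ i → mono (Vec.tabulate (δ (z i)))))
mono-occ {n} {zero}  z .at φ = cong (λ α → 1ℚ ℚ.* φ α ℚ.+ 0ℚ) (sym (replicate-tabulate n))
mono-occ {n} {suc l} z = ≋-trans (mono-occ-∷ (z zero) (tabulate (z ∘ suc)))
  (*ₚ-congˡ (mono (Vec.tabulate (δ (z zero)))) (mono-occ (z ∘ suc)))

module _ {n : ℕ} (φ : Monomial n → ℚ) where

  eval-tabulate-0 : ∀ {l} (x : Fin l → ℚ) (g : Fin l → Monomial n) → (∀ i → x i ≡ 0ℚ) → eval (tabulate (λ i → x i , g i)) φ ≡ 0ℚ
  eval-tabulate-0 {zero}  x g x≡0 = refl
  eval-tabulate-0 {suc l} x g x≡0 = trans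
    (cong₂ (λ a b → a ℚ.* φ (g zero) ℚ.+ b) (x≡0 zero) (eval-tabulate-0 (x ∘ suc) (g ∘ suc) (x≡0 ∘ suc)))
    (solve 1 (λ y → con 0ℚ :* y :+ con 0ℚ := con 0ℚ) refl (φ (g zero)))

  eval-tabulate-unit : ∀ {l} (x : Fin l → ℚ) (g : Fin l → Monomial n) j → x j ≡ 1ℚ → (∀ {i} → j ≢ i → x i ≡ 0ℚ) →
    eval (tabulate (λ i → x i , g i)) φ ≡ φ (g j)
  eval-tabulate-unit x g zero x≡1 x≡0 = trans
    (cong₂ (λ a b → a ℚ.* φ (g zero) ℚ.+ b) x≡1 (eval-tabulate-0 (x ∘ suc) (g ∘ suc) (λ i → x≡0 λ ())))
    (solve 1 (λ y → con 1ℚ :* y :+ con 0ℚ := y) refl (φ (g zero)))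
  eval-tabulate-unit x g (suc j) x≡1 x≡0 = trans
    (cong₂ (λ a b → a ℚ.* φ (g zero) ℚ.+ b) (x≡0 λ ())
      (eval-tabulate-unit (x ∘ suc) (g ∘ suc) j x≡1 (λ j≢i → x≡0 (j≢i ∘ suc-injective))))
    (solve 2 (λ y z → con 0ℚ :* y :+ z := z) refl (φ (g zero)) (φ (g (suc j))))

  eval-tabulate-minus : ∀ {l} (x y : Fin l → ℚ) (g : Fin l → Monomial n) → eval (tabulate (λ i → x i ℚ.- y i , g i)) φ ≡
    eval (tabulate (λ i → x i , g i)) φ ℚ.- eval (tabulate (λ i → y i , g i)) φ
  eval-tabulate-minus {zero}  x y g = refl
  eval-tabulate-minus {suc l} x y g = trans
    (cong ((x zero ℚ.- y zero) ℚ.* φ (g zero) ℚ.+_) (eval-tabulate-minus (x ∘ suc) (y ∘ suc) (g ∘ suc)))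
    (solve 5 (λ x y z a b → (x :- y) :* z :+ (a :- b) := (x :* z :+ a) :- (y :* z :+ b)) refl
      (x zero) (y zero) (φ (g zero))
      (eval (tabulate (λ i → x (suc i) , g (suc i))) φ) (eval (tabulate (λ i → y (suc i) , g (suc i))) φ))

  eval-linP : ∀ (x : Vector n) → eval (linP x) φ ≡ eval (tabulate (λ i → x i , Vec.tabulate (δ i))) φ
  eval-linP x = cong (λ p → eval p φ) (ListP.map-tabulate id (λ i → x i , Vec.tabulate (δ i)))

  eval-linP-spoke : ∀ j → eval (linP (column (zero , suc j))) φ ≡ φ (Vec.tabulate (δ j))
  eval-linP-spoke j = trans (eval-linP x) (eval-tabulate-unit x (λ i → Vec.tabulate (δ i)) j
    (cong (ℚ._- 0ℚ) (evec-≡ j)) (λ j≢i → cong (ℚ._- 0ℚ) (evec-≢ j≢i)))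
    where
    x : Vector n
    x = column (zero , suc j)

  eval-linP-tree : ∀ j l →
    eval (linP (column (suc l , suc j))) φ ≡ φ (Vec.tabulate (δ j)) ℚ.- φ (Vec.tabulate (δ l))
  eval-linP-tree j l = trans (eval-linP (column (suc l , suc j)))
    (trans (eval-tabulate-minus (evec (suc j)) (evec (suc l)) (λ i → Vec.tabulate (δ i)))
      (cong₂ ℚ._-_ (unit j) (unit l)))
    where
    unit : ∀ j → eval (tabulate (λ i → evec (suc j) i , Vec.tabulate (δ i))) φ ≡ φ (Vec.tabulate (δ j))
    unit j = eval-tabulate-unit (evec (suc j)) (λ i → Vec.tabulate (δ i)) j (evec-≡ j) evec-≢

  eval-mono : ∀ α → eval (mono α) φ ≡ φ α
  eval-mono α = solve 1 (λ x → con 1ℚ :* x :+ con 0ℚ := x) refl (φ α)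

-- Sub-multisets and their complements

merge : ∀ {n} {R B X : List (Vector n)} → Interleaving R B X →
  ∀ {cs ds} → Pointwise Nonzero R cs → Pointwise Nonzero B ds →
  ∃ λ es → Pointwise Nonzero X es × (∀ v → occ es v ≡ occ cs v ℕ.+ occ ds v)
merge [] [] [] = [] , [] , λ v → refl
merge (consˡ sp) {c ∷ cs} {ds} (nz ∷ nzs) nzs′ with merge sp nzs nzs′
... | es , nz-es , e = c ∷ es , nz ∷ nz-es , λ v →
  trans (cong (δ c v ℕ.+_) (e v)) (sym (ℕP.+-assoc (δ c v) (occ cs v) (occ ds v)))
merge (consʳ sp) {cs} {d ∷ ds} nzs (nz ∷ nzs′) with merge sp nzs nzs′
... | es , nz-es , e = d ∷ es , nz ∷ nz-es , λ v →
  trans (cong (δ d v ℕ.+_) (e v)) (x∙yz≈y∙xz ℕP.+-commutativeSemigroup (δ d v) (occ cs v) (occ ds v))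

select-interleaving : ∀ {A : Set} (xs : List A) b →
  Interleaving (select xs b) (select xs (Vec.map not b)) xs
select-interleaving []       []          = []
select-interleaving (x ∷ xs) (true ∷ b)  = consˡ (select-interleaving xs b)
select-interleaving (x ∷ xs) (false ∷ b) = consʳ (select-interleaving xs b)

-- Turns a splitting that is given structurally into the Boolean selection that `InP` asks for.
interleaving-select : ∀ {A : Set} {R B xs : List A} → Interleaving R B xs →
  ∃ λ b → select xs b ≡ R × select xs (Vec.map not b) ≡ B
interleaving-select [] = [] , refl , refl
interleaving-select (consˡ sp) with interleaving-select sp
... | b , refl , refl = true ∷ b , refl , refl
interleaving-select (consʳ sp) with interleaving-select sp
... | b , refl , refl = false ∷ b , refl , refl

pick-interleaving : ∀ {A : Set} {m} (e : Fin m → A) h →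
  Interleaving (pick e h) (pick e (Vec.map not h)) (tabulate e)
pick-interleaving e []          = []
pick-interleaving e (true ∷ h)  = consˡ (pick-interleaving (e ∘ suc) h)
pick-interleaving e (false ∷ h) = consʳ (pick-interleaving (e ∘ suc) h)

map-pick : ∀ {A B : Set} {m} (f : A → B) (e : Fin m → A) h → map f (pick e h) ≡ pick (f ∘ e) h
map-pick f e []          = refl
map-pick f e (true ∷ h)  = cong (f (e zero) ∷_) (map-pick f (e ∘ suc) h)
map-pick f e (false ∷ h) = map-pick f (e ∘ suc) h

pick-∈ : ∀ {A : Set} {m} (e : Fin m → A) h i → lookup h i ≡ true → e i ∈ pick e h
pick-∈ e (true ∷ h)  zero    _  = here refl
pick-∈ e (true ∷ h)  (suc i) hi = there (pick-∈ (e ∘ suc) h i hi)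
pick-∈ e (false ∷ h) (suc i) hi = pick-∈ (e ∘ suc) h i hi

pointwise-++⁻ : ∀ {A B : Set} {P : A → B → Set} xs {ys cs} → Pointwise P (xs ++ ys) cs →
  ∃ λ as → ∃ λ bs → cs ≡ as ++ bs × Pointwise P xs as × Pointwise P ys bs
pointwise-++⁻ []       ps = [] , _ , refl , [] , ps
pointwise-++⁻ (x ∷ xs) (p ∷ ps) with pointwise-++⁻ xs ps
... | as , bs , refl , pa , pb = _ ∷ as , bs , refl , p ∷ pa , pb

pointwise-tabulate⁻ : ∀ {A B : Set} {P : A → B → Set} {m} (a : Fin m → A) {cs} → Pointwise P (tabulate a) cs →
  ∃ λ c → cs ≡ tabulate c × (∀ i → P (a i) (c i))
pointwise-tabulate⁻ {m = zero}  a []       = (λ ()) , refl , λ ()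
pointwise-tabulate⁻ {B = B} {P} {suc m} a {c₀ ∷ _} (p ∷ ps) with pointwise-tabulate⁻ (a ∘ suc) ps
... | c , refl , pc = c′ , refl , pc′
  where
  c′ : Fin (suc m) → B
  c′ zero    = c₀
  c′ (suc i) = c i
  pc′ : ∀ i → P (a i) (c′ i)
  pc′ zero    = p
  pc′ (suc i) = pc i

-- The wheel graph of a rooted tree

iter-suc : ∀ {A : Set} (f : A → A) k a → iter f (suc k) a ≡ iter f k (f a)
iter-suc f zero    a = refl
iter-suc f (suc k) a = cong f (iter-suc f k a)

iter-fixed : ∀ {A : Set} (f : A → A) k {a} → f a ≡ a → iter f k a ≡ a
iter-fixed f zero    e = refl
iter-fixed f (suc k) e = trans (cong f (iter-fixed f k e)) e

bounded : ∀ {n} (f : Fin n → ℕ) → ∃ λ M → ∀ i → f i ≤ M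
bounded {zero}  f = 0 , λ ()
bounded {suc n} f with bounded (f ∘ suc)
... | M , ≤M = f zero ℕ.+ M , λ { zero → ℕP.m≤m+n (f zero) M ; (suc i) → ℕP.m≤n⇒m≤o+n (f zero) (≤M i) }

spoke-nonzero : ∀ {n} {j i : Fin n} → Nonzero (column (zero , suc j)) i → i ≡ j
spoke-nonzero {j = j} {i} nz with j ≟ᶠ i
... | yes j≡i = sym j≡i
... | no j≢i  = contradiction refl nz

tree-nonzero : ∀ {n} {j l i : Fin n} → Nonzero (column (suc l , suc j)) i → i ≡ j ⊎ i ≡ l
tree-nonzero {j = j} {l} {i} nz with j ≟ᶠ i | l ≟ᶠ i
... | yes j≡i | _       = inj₁ (sym j≡i)
... | no _    | yes l≡i = inj₂ (sym l≡i)
... | no _    | no _    = contradiction refl nz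

Heads : ∀ {n} → List (Edge n) → List (Fin n) → Set
Heads = Pointwise (λ e h → proj₂ e ≡ suc h)

indeg-occ : ∀ {n} {es : List (Edge n)} {hs} → Heads es hs → ∀ v → indeg es (suc v) ≡ occ hs v
indeg-occ [] v = refl
indeg-occ {es = (_ , _) ∷ _} {h ∷ _} (refl ∷ ps) v with h ≟ᶠ v
... | yes _ = cong suc (indeg-occ ps v)
... | no _  = indeg-occ ps v

module _ {m : ℕ} (T : RootedTree m) where

  par : Fin m → Fin (suc m)
  par i = parent T (suc i)

  -- A vertex that is its own parent is fixed by every iterate of the parent map, so it could reach
  -- the root only by being the root.
  par≢self : ∀ i → par i ≢ suc i
  par≢self i e with reaches T (suc i)
  ... | k , r with trans (sym (iter-fixed (parent T) k e)) r
  ...   | ()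

  target : Vec Sign (suc m) → Fin m → Fin (suc m)
  target k i with lookup k (suc i)
  ... | Sign.+ = suc i
  ... | Sign.- = par i

  target-plus : ∀ k i → lookup k (suc i) ≡ Sign.+ → target k i ≡ suc i
  target-plus k i e rewrite e = refl

  target-minus : ∀ k i → lookup k (suc i) ≡ Sign.- → target k i ≡ par i
  target-minus k i e rewrite e = refl

  spokes : Fin m → Edge (suc m)
  spokes i = zero , suc (suc i)

  GBW-tabulate : ∀ k → GBW T k ≡
    (zero , suc zero) ∷ (zero , suc zero) ∷ (tabulate spokes ++ tabulate (λ i → treeEdge T k (suc i)))
  GBW-tabulate k = cong₂ (λ xs ys → (zero , suc zero) ∷ (zero , suc zero) ∷ (xs ++ ys))
    (ListP.map-tabulate id spokes) (ListP.map-tabulate id (λ i → treeEdge T k (suc i)))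

  rootColumn : Vector (suc m)
  rootColumn = column (zero , suc zero)

  spokeColumn treeColumn : Fin m → Vector (suc m)
  spokeColumn i = column (spokes i)
  treeColumn i  = column (suc (par i) , suc (suc i))

  GX-tabulate : GX T ≡ rootColumn ∷ rootColumn ∷ (tabulate spokeColumn ++ tabulate treeColumn)
  GX-tabulate = trans (cong (map column) (GBW-tabulate (allPlus m)))
    (cong (λ xs → rootColumn ∷ rootColumn ∷ xs) (trans
      (ListP.map-++ column (tabulate spokes) _)
      (cong₂ _++_ (ListP.map-tabulate spokes column)
        (trans (ListP.map-tabulate _ column) (ListP.tabulate-cong (λ i → cong column (plus i)))))))
    where
    plus : ∀ i → treeEdge T (allPlus m) (suc i) ≡ (suc (par i) , suc (suc i))
    plus i rewrite VecP.lookup-replicate i Sign.+ = refl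

  length-GX : length (GX T) ≡ suc m ℕ.+ suc m
  length-GX = begin
    length (GX T)
      ≡⟨ cong length GX-tabulate ⟩
    suc (suc (length (tabulate spokeColumn ++ tabulate treeColumn)))
      ≡⟨ cong (λ l → suc (suc l)) (ListP.length-++ (tabulate spokeColumn)) ⟩
    suc (suc (length (tabulate spokeColumn) ℕ.+ length (tabulate treeColumn)))
      ≡⟨ cong₂ (λ a b → suc (suc (a ℕ.+ b))) (ListP.length-tabulate spokeColumn) (ListP.length-tabulate treeColumn) ⟩
    suc (suc (m ℕ.+ m))
      ≡⟨ cong suc (ℕP.+-suc m m) ⟨
    suc m ℕ.+ suc m ∎

  -- The heads of all 2n edges when tree edge i points to c i.
  heads : (Fin m → Fin (suc m)) → List (Fin (suc m))
  heads c = zero ∷ zero ∷ (tabulate suc ++ tabulate c)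

  -- One of the two root edges and the spokes together enter every vertex exactly once. This
  -- accounts for the 1 subtracted in the weight; the other root edge and the tree edges remain.
  occ-heads : ∀ c v → occ (heads c) v ≡ suc (occ (zero ∷ tabulate c) v)
  occ-heads c v = begin
    δ zero v ℕ.+ (δ zero v ℕ.+ occ (tabulate suc ++ tabulate c) v)
      ≡⟨ cong (λ x → δ zero v ℕ.+ (δ zero v ℕ.+ x)) (occ-++ (tabulate suc) (tabulate c) v) ⟩
    δ zero v ℕ.+ (δ zero v ℕ.+ (occ (tabulate suc) v ℕ.+ occ (tabulate c) v))
      ≡⟨ cong (δ zero v ℕ.+_) (ℕP.+-assoc (δ zero v) (occ (tabulate suc) v) (occ (tabulate c) v)) ⟨
    δ zero v ℕ.+ (occ (allFin (suc m)) v ℕ.+ occ (tabulate c) v)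
      ≡⟨ cong (λ x → δ zero v ℕ.+ (x ℕ.+ occ (tabulate c) v)) (occ-allFin (suc m) v) ⟩
    δ zero v ℕ.+ suc (occ (tabulate c) v)
      ≡⟨ ℕP.+-suc (δ zero v) (occ (tabulate c) v) ⟩
    suc (occ (zero ∷ tabulate c) v) ∎

  GBW-heads : ∀ k → Heads (GBW T k) (heads (target k))
  GBW-heads k rewrite GBW-tabulate k =
    refl ∷ refl ∷ PW.++⁺ (PW.tabulate⁺ (λ i → refl)) (PW.tabulate⁺ tree-head)
    where
    tree-head : ∀ i → proj₂ (treeEdge T k (suc i)) ≡ suc (target k i)
    tree-head i with lookup k (suc i)
    ... | Sign.+ = refl
    ... | Sign.- = refl

  weight-occ : ∀ k v → weight T k v ≡ occ (zero ∷ tabulate (target k)) v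
  -- The indegree is a successor, so the truncated subtraction is exact.
  weight-occ k v = cong (ℕ._∸ 1) (trans (indeg-occ (GBW-heads k) v) (occ-heads (target k) v))

  Ref-occ : ∀ k → Ref T k ≡ Vec.tabulate (occ (zero ∷ tabulate (target k)))
  Ref-occ k = VecP.tabulate-cong (weight-occ k)

  -- Monomials of degree n in the space

  GX-transversal : ∀ {cs} → Pointwise Nonzero (GX T) cs →
    ∃ λ c → cs ≡ heads c × (∀ i → c i ≡ suc i ⊎ c i ≡ par i)
  GX-transversal {cs} nzs with subst (λ X → Pointwise Nonzero X cs) GX-tabulate nzs
  ... | nz₁ ∷ nz₂ ∷ rest with pointwise-++⁻ (tabulate spokeColumn) rest
  ...   | as , bs , refl , nz-as , nz-bs with pointwise-tabulate⁻ spokeColumn nz-as | pointwise-tabulate⁻ treeColumn nz-bs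
  ...     | a , refl , nz-a | c , refl , nz-c = c ,
    cong₂ _∷_ (spoke-nonzero nz₁) (cong₂ _∷_ (spoke-nonzero nz₂)
      (cong (_++ tabulate c) (ListP.tabulate-cong (λ i → spoke-nonzero (nz-a i))))) ,
    λ i → tree-nonzero (nz-c i)

  -- Reads an orientation off a choice of ends: plus exactly where the edge points away from the
  -- root. The root itself gets plus, as `SignVec` requires.
  signs : (Fin m → Fin (suc m)) → Vec Sign (suc m)
  signs c = Sign.+ ∷ Vec.tabulate (λ i → if does (c i ≟ᶠ suc i) then Sign.+ else Sign.-)

  target-signs : ∀ c → (∀ i → c i ≡ suc i ⊎ c i ≡ par i) → ∀ i → target (signs c) i ≡ c i
  target-signs c ends i rewrite VecP.lookup∘tabulate (λ i → if does (c i ≟ᶠ suc i) then Sign.+ else Sign.-) i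
    with c i ≟ᶠ suc i | ends i
  ... | yes e | _      = sym e
  ... | no ¬e | inj₁ e = contradiction e ¬e
  ... | no ¬e | inj₂ e = sym e

  refMonomial : SignVec m → Monomial (suc m)
  refMonomial k = Ref T (proj₁ k)

  -- A monomial of p_R picks an end ≠ 0 of every edge of R and the basis transversal an end ≠ 0 of every
  -- edge of the complement, each vertex once; together they orient the whole graph.
  support-is-Ref : ∀ f → InPn T f → ∀ α → coeff f α ≢ 0ℚ → ∃ λ (k : SignVec m) → refMonomial k ≡ α
  support-is-Ref f ((L , full , f≈L) , hom) α ≢0
    with coeff-lincomb-≢0 (λ b → pR (select (GX T) b)) {λ b → FullRank (select (GX T) (Vec.map not b))}
           L α full (subst (_≢ 0ℚ) (f≈L α) ≢0)
  ... | b , full-b , pR≢0 with coeff-supported (pR R) α (pR-supported R) pR≢0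
    where R = select (GX T) b
  ... | cs , nz-R , refl with basis-transversal B length-B full-b
    where
    R = select (GX T) b
    B = select (GX T) (Vec.map not b)
    length-R : length R ≡ suc m
    length-R = trans (PW.Pointwise-length nz-R) (trans (sym (sum-occ cs))
      (decidable-stable (Vec.sum (Vec.tabulate (occ cs)) ℕP.≟ suc m) (λ ≢n → ≢0 (hom _ ≢n))))
    length-B : length B ≡ suc m
    length-B = ℕP.+-cancelˡ-≡ (suc m) _ _ (begin
      suc m ℕ.+ length B       ≡⟨ cong (ℕ._+ length B) length-R ⟨
      length R ℕ.+ length B    ≡⟨ interleave-length (select-interleaving (GX T) b) ⟨
      length (GX T)            ≡⟨ length-GX ⟩
      suc m ℕ.+ suc m          ∎)
  ... | ds , nz-B , ds≡1 with merge (select-interleaving (GX T) b) nz-R nz-B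
  ... | es , nz-X , es≡ with GX-transversal nz-X
  ... | c , refl , ends = (signs c , refl) , trans (Ref-occ (signs c)) (VecP.tabulate-cong λ v → ℕP.suc-injective (begin
    suc (occ (zero ∷ tabulate (target (signs c))) v)
      ≡⟨ cong (λ xs → suc (occ (zero ∷ xs) v)) (ListP.tabulate-cong (target-signs c ends)) ⟩
    suc (occ (zero ∷ tabulate c) v)   ≡⟨ occ-heads c v ⟨
    occ (heads c) v                   ≡⟨ es≡ v ⟩
    occ cs v ℕ.+ occ ds v             ≡⟨ cong (occ cs v ℕ.+_) (ds≡1 v) ⟩
    occ cs v ℕ.+ 1                    ≡⟨ ℕP.+-comm (occ cs v) 1 ⟩
    suc (occ cs v)                    ∎))

  -- Reference monomials lie in the P-space

  spokeP treeP : Fin m → Poly (suc m)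
  spokeP i = linP (spokeColumn i)
  treeP i  = linP (treeColumn i)

  -- The multiple of t_i - t_p that is added to t_i: 0 to keep t_i, and -1 to obtain t_p.
  targetCoeff : Vec Sign (suc m) → Fin m → ℚ
  targetCoeff k i with lookup k (suc i)
  ... | Sign.+ = 0ℚ
  ... | Sign.- = ℚ.- 1ℚ

  target-expand : ∀ k i → mono (Vec.tabulate (δ (target k i))) ≋ spokeP i +ₚ scaleP (targetCoeff k i) (treeP i)
  target-expand k i .at φ = trans (eval-mono φ _) (trans step (sym (trans
    (eval-++ (spokeP i) _ φ) (cong₂ ℚ._+_ (eval-linP-spoke φ (suc i))
      (trans (eval-scale (targetCoeff k i) (treeP i) φ) (cong (targetCoeff k i ℚ.*_) (eval-linP-tree φ (suc i) (par i))))))))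
    where
    x = φ (Vec.tabulate (δ (suc i)))
    y = φ (Vec.tabulate (δ (par i)))
    step : φ (Vec.tabulate (δ (target k i))) ≡ x ℚ.+ targetCoeff k i ℚ.* (x ℚ.- y)
    step with lookup k (suc i)
    ... | Sign.+ = solve 2 (λ x y → x := x :+ con 0ℚ :* (x :- y)) refl x y
    ... | Sign.- = solve 2 (λ x y → y := x :+ (:- con 1ℚ) :* (x :- y)) refl x y

  -- At each non-root vertex one of its two columns, spoke or tree edge, becomes a factor and the
  -- other stays in the complement. The two parallel root columns are divided likewise.
  chosen unchosen : Vec Bool m → List (Vector (suc m))
  chosen h   = rootColumn ∷ (pick spokeColumn h ++ pick treeColumn (Vec.map not h))
  unchosen h = rootColumn ∷ (pick spokeColumn (Vec.map not h) ++ pick treeColumn h)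

  chosen-interleaving : ∀ h → Interleaving (chosen h) (unchosen h) (GX T)
  chosen-interleaving h = subst (Interleaving (chosen h) (unchosen h)) (sym GX-tabulate)
    (consˡ (consʳ (interleaving-++⁺ (pick-interleaving spokeColumn h) (swap (pick-interleaving treeColumn h)))))

  selection : Vec Bool m → Vec Bool (length (GX T))
  selection h = proj₁ (interleaving-select (chosen-interleaving h))

  -- Every unit vector is obtained by walking towards the root: either the spoke of the vertex is
  -- present, or its tree column is added to the unit vector of its parent. The number of steps to
  -- the root decreases.
  unchosen-fullRank : ∀ h → FullRank (unchosen h)
  unchosen-fullRank h v = span⇒combination S (span-from-units S v λ j _ → inj₂ (unit (proj₁ (reaches T j)) j (proj₂ (reaches T j))))
    where
    S = unchosen h
    unit : ∀ d j → iter (parent T) d j ≡ zero → SpanOff [] S (evec (suc j))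
    -- The root is settled by the root column, whatever number of steps is left.
    unit d zero _ = span-resp S (λ i _ → ℚP.+-identityʳ (evec (suc zero) i)) (span-∈ {S = S} (here refl))
    unit zero (suc i) ()
    unit (suc d) (suc i) r = cases (lookup h i) refl
      where
      cases : ∀ b → lookup h i ≡ b → SpanOff [] S (evec (suc (suc i)))
      cases true hi = span-resp S {λ j → treeColumn i j ℚ.+ 1ℚ ℚ.* evec (suc (par i)) j}
        (λ j _ → solve 2 (λ e p → (e :- p) :+ con 1ℚ :* p := e) refl (evec (suc (suc i)) j) (evec (suc (par i)) j))
        (span-+ S {treeColumn i} {evec (suc (par i))} 1ℚ (span-∈ (there (∈-++⁺ʳ (pick spokeColumn (Vec.map not h)) (pick-∈ treeColumn h i hi))))
          (unit d (par i) (trans (sym (iter-suc (parent T) d (suc i))) r)))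
      cases false hi = span-resp S (λ j _ → ℚP.+-identityʳ (evec (suc (suc i)) j))
        (span-∈ (there (∈-++⁺ˡ (pick-∈ spokeColumn (Vec.map not h) i
          (trans (VecP.lookup-map i not h) (cong not hi))))))

  pR-chosen : ∀ h → linP rootColumn *ₚ prodP (tabulate (branch spokeP treeP h)) ≋ pR (select (GX T) (selection h))
  pR-chosen h = subst (λ R → linP rootColumn *ₚ prodP (tabulate (branch spokeP treeP h)) ≋ pR R)
    (sym (proj₁ (proj₂ (interleaving-select (chosen-interleaving h)))))
    (*ₚ-congˡ (linP rootColumn) (subst (λ ps → prodP (tabulate (branch spokeP treeP h)) ≋ prodP ps) (sym picks)
      (prodP-branch spokeP treeP h)))
    where
    picks : map linP (pick spokeColumn h ++ pick treeColumn (Vec.map not h)) ≡ pick spokeP h ++ pick treeP (Vec.map not h)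
    picks = trans (ListP.map-++ linP (pick spokeColumn h) _)
      (cong₂ _++_ (map-pick linP spokeColumn h) (map-pick linP treeColumn (Vec.map not h)))

  -- The factor t_p of Ref is expanded as t_i − (t_i − t_p).
  Ref-InP : ∀ k → InP T (mono (Ref T k))
  Ref-InP k with prodP-expand (λ i → mono (Vec.tabulate (δ (target k i)))) spokeP treeP (targetCoeff k) (target-expand k)
  ... | L , expansion = map (λ t → proj₁ t , selection (proj₂ t)) L , AllP.map⁺ (All.universal full L) , ≋⇒≈ₚ eq
    where
    full : ∀ t → FullRank (select (GX T) (Vec.map not (selection (proj₂ t))))
    full (_ , h) = subst FullRank (sym (proj₂ (proj₂ (interleaving-select (chosen-interleaving h))))) (unchosen-fullRank h)
    root : mono (Vec.tabulate (δ zero)) ≋ linP rootColumn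
    root .at φ = trans (eval-mono φ _) (sym (eval-linP-spoke φ zero))
    P : Vec Bool (length (GX T)) → Poly (suc m)
    P b = pR (select (GX T) b)
    eq : mono (Ref T k) ≋ lincomb P (map (λ t → proj₁ t , selection (proj₂ t)) L)
    eq = subst (λ α → mono α ≋ lincomb P (map (λ t → proj₁ t , selection (proj₂ t)) L)) (sym (Ref-occ k))
      (≋-trans (mono-occ-∷ zero (tabulate (target k)))
      (≋-trans (*ₚ-cong root (≋-trans (mono-occ (target k)) expansion))
      (≋-trans (*ₚ-lincomb (linP rootColumn) (λ h → prodP (tabulate (branch spokeP treeP h))) L)
        (lincomb-cong {Q = P} selection pR-chosen L))))

  Ref-homogeneous : ∀ k → Homogeneous (suc m) (mono (Ref T k))
  Ref-homogeneous k α ≢n = coeff-mono-≢ {α = Ref T k} {α} λ { refl → ≢n (begin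
    Vec.sum (Ref T k)                                                ≡⟨ cong Vec.sum (Ref-occ k) ⟩
    Vec.sum (Vec.tabulate (occ (zero ∷ tabulate (target k))))        ≡⟨ sum-occ (zero ∷ tabulate (target k)) ⟩
    suc (length (tabulate (target k)))                               ≡⟨ cong suc (ListP.length-tabulate (target k)) ⟩
    suc m                                                            ∎) }

  Ref-InPn : ∀ k → InPn T (mono (Ref T k))
  Ref-InPn k = Ref-InP k , Ref-homogeneous k

  -- Distinct sign vectors have distinct reference monomials

  module _ (k k′ : Vec Sign (suc m)) (same : Ref T k ≡ Ref T k′) where

    Differ : Fin m → Set
    Differ i = lookup k (suc i) ≡ Sign.+ × lookup k′ (suc i) ≡ Sign.-

    occ-target : ∀ v → occ (tabulate (target k)) v ≡ occ (tabulate (target k′)) v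
    occ-target v = ℕP.+-cancelˡ-≡ (δ zero v) _ _ (begin
      occ (zero ∷ tabulate (target k)) v     ≡⟨ weight-occ k v ⟨
      weight T k v                           ≡⟨ VecP.lookup∘tabulate (weight T k) v ⟨
      lookup (Ref T k) v                     ≡⟨ cong (λ α → lookup α v) same ⟩
      lookup (Ref T k′) v                    ≡⟨ VecP.lookup∘tabulate (weight T k′) v ⟩
      weight T k′ v                          ≡⟨ weight-occ k′ v ⟩
      occ (zero ∷ tabulate (target k′)) v    ∎)

    -- The tree edge of vertex `suc i` enters it under `k` but not under `k′`. For the counts to
    -- agree, some other tree edge must enter it under `k′` but not under `k`, and only the edge
    -- from a differing child does so.
    differing-child : ∀ i → Differ i → ∃ λ j → par j ≡ suc i × Differ j
    differing-child i (ki , k′i)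
      with any? (λ j → (target k′ j ≟ᶠ suc i) ×-dec ¬? (target k j ≟ᶠ suc i))
    ... | no none = contradiction (sym (occ-target (suc i))) (ℕP.<⇒≢
            (occ-tabulate-< (target k) (target k′) (suc i) imp i (target-plus k i ki)
              -- Under `k′` this edge points to the parent, which is a different vertex.
              (λ e → par≢self i (trans (sym (target-minus k′ i k′i)) e))))
      where
      imp : ∀ j → target k′ j ≡ suc i → target k j ≡ suc i
      imp j e = decidable-stable (target k j ≟ᶠ suc i) (λ ne → none (j , e , ne))
    ... | yes (j , e′ , ne) with lookup k (suc j) in kj | lookup k′ (suc j) in k′j
    ...   | Sign.+ | Sign.- = j , e′ , kj , k′j
    ...   | Sign.- | Sign.- = contradiction e′ ne
    -- Here the edge points to its own lower end under `k′`, so `j` is `i`, where `k′` has the sign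
    -- minus.
    ...   | _      | Sign.+ with e′
    ...     | refl with trans (sym k′i) k′j
    ...       | ()

    -- Differing vertices propagate to children, giving arbitrarily long paths that miss the root.
    long-path : ∀ i → Differ i → ∀ d → ∃ λ j → Differ j × (∀ t → t ≤ d → iter (parent T) t (suc j) ≢ zero)
    long-path i di zero = i , di , λ { _ z≤n () }
    long-path i di (suc d) with long-path i di d
    ... | j , dj , avoid with differing-child j dj
    ...   | l , par-l , dl = l , dl , avoid′
      where
      avoid′ : ∀ t → t ≤ suc d → iter (parent T) t (suc l) ≢ zero
      avoid′ zero    _         = λ ()
      avoid′ (suc t) (s≤s t≤d) e = avoid t t≤d (begin
        iter (parent T) t (suc j)         ≡⟨ cong (iter (parent T) t) par-l ⟨
        iter (parent T) t (par l)         ≡⟨ iter-suc (parent T) t (suc l) ⟨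
        iter (parent T) (suc t) (suc l)   ≡⟨ e ⟩
        zero                              ∎)

    -- `M` bounds the numbers of steps supplied by `reaches`, so the end of a path built for `d`
    -- equal to `M` must meet the root where it is known to avoid it.
    ¬Differ : ∀ i → ¬ Differ i
    ¬Differ i di =
      let M , ≤M = bounded (λ j → proj₁ (reaches T (suc j)))
          j , _ , avoid = long-path i di M
      in avoid _ (≤M j) (proj₂ (reaches T (suc j)))

  Ref-injective : ∀ {k k′ : SignVec m} → refMonomial k ≡ refMonomial k′ → proj₁ k ≡ proj₁ k′
  Ref-injective {k , k₁} {k′ , k′₁} same = begin
    k                         ≡⟨ VecP.tabulate∘lookup k ⟨
    Vec.tabulate (lookup k)   ≡⟨ VecP.tabulate-cong agree ⟩
    Vec.tabulate (lookup k′)  ≡⟨ VecP.tabulate∘lookup k′ ⟩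
    k′                        ∎
    where
    agree : ∀ v → lookup k v ≡ lookup k′ v
    agree zero    = trans k₁ (sym k′₁)
    agree (suc i) with lookup k (suc i) in ki | lookup k′ (suc i) in k′i
    ... | Sign.+ | Sign.+ = refl
    ... | Sign.- | Sign.- = refl
    ... | Sign.+ | Sign.- = contradiction (ki , k′i) (¬Differ k k′ same i)
    ... | Sign.- | Sign.+ = contradiction (k′i , ki) (¬Differ k′ k (sym same) i)

  -- Spanning, and the basis statement

  Ref-spans : ∀ f → InPn T f → ∃ λ L → f ≈ₚ lincomb (mono ∘ refMonomial) L
  -- The monomials written in the list `f` contain its support, so they serve as the finite list to
  -- be cleared.
  Ref-spans f f∈ = expand-over refMonomial (map proj₂ f) f (coeff-≢0⇒∈ f) (support-is-Ref f f∈)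

theorem6 : ∀ (m : ℕ) (T : RootedTree m) →
    (∀ f → InPn T f → ∃ λ (L : List (ℚ × Monomial (suc m))) →
    All (λ t → InPn T (mono (proj₂ t))) L ×
    f ≈ₚ sumP (map (λ t → scaleP (proj₁ t) (mono (proj₂ t))) L)) ×
    (∀ (k : Vec Sign (suc m)) → lookup k zero ≡ Sign.+ → InPn T (mono (Ref T k))) ×
    (∀ f → InPn T f → ∃ λ (L : List (ℚ × SignVec m)) →
    f ≈ₚ sumP (map (λ t → scaleP (proj₁ t) (mono (Ref T (proj₁ (proj₂ t))))) L)) ×
    (∀ (L : List (ℚ × SignVec m)) → Unique (map (λ t → proj₁ (proj₂ t)) L) →
    sumP (map (λ t → scaleP (proj₁ t) (mono (Ref T (proj₁ (proj₂ t))))) L) ≈ₚ zeroP →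
    All (λ t → proj₁ t ≡ 0ℚ) L)
theorem6 m T = monomials , (λ k _ → Ref-InPn T k) , Ref-spans T ,
  mono-independent (refMonomial T) proj₁
  (λ {h} {h′} → Ref-injective T {h} {h′})
  where
  -- Spanning by monomials of the space follows from spanning by reference monomials, since these
  -- lie in the space.
  monomials : ∀ f → InPn T f → ∃ λ (L : List (ℚ × Monomial (suc m))) →
    All (λ t → InPn T (mono (proj₂ t))) L × f ≈ₚ lincomb mono L
  monomials f f∈ with Ref-spans T f f∈
  ... | L , f≈L = map (λ t → proj₁ t , refMonomial T (proj₂ t)) L ,
    AllP.map⁺ (All.universal (λ t → Ref-InPn T (proj₁ (proj₂ t))) L) ,
    λ α → trans (f≈L α) (≋⇒≈ₚ (lincomb-cong {P = mono ∘ refMonomial T} {Q = mono} (refMonomial T) (λ h → ≋-refl {p = mono (refMonomial T h)}) L) α)
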